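{- Let $(\alpha_n)_{n\ge0}$ be complex numbers with $|\alpha_n|<1$ and let $\mu_{n,r,s}$ be as in the context. For all nonnegative integers $n,r,s$, \[ \mu_{n,r,s}=\sum_{p\in\mathfrak{L}_{n,r,s}}\mathrm{wt}_L(p). \]
   Context: For a polynomial $f(z)=\sum_{k=0}^n a_kz^k$ of degree $n$, write $\overline{f}(z)=\sum_k\overline{a_k}z^k$ and $f^*(z)=z^n\overline{f}(1/z)$. Define monic $\Phi_n$ by $\Phi_0=1$, $\Phi_{n+1}(z)=z\Phi_n(z)-\overline{\alpha_n}\Phi_n^*(z)$. Let $\mathcal{L}$ be the unique linear functional on Laurent polynomials with $\mathcal{L}(1)=1$ and $\mathcal{L}(\Phi_m(z)\overline{\Phi_n}(1/z))=0$ for $m\neq n$; set $\langle f,g\rangle=\mathcal{L}(f(z)\overline{g}(1/z))$ and $\mu_{n,r,s}=\langle\Phi_s(z),z^n\Phi_r(z)\rangle/\langle\Phi_s,\Phi_s\rangle$. Set $\alpha_{ -1}=-1$. A Łukasiewicz path is a finite sequence of lattice points in $\mathbb{Z}\times\mathbb{Z}_{\ge0}$ whose steps are of the form $(1,k)$ with $k\le 1$ integer; $\mathfrak{L}_{n,r,s}$ is the set of such paths from $(0,r)$ to $(n,s)$. The weight $\mathrm{wt}_L(p)$ is the product of the weights of the steps, where an up-step $(a,b)\to(a+1,b+1)$ has weight $1$ and a step $(a,b)\to(a+1,b-k)$, $k=0,1,\dots,b$, has weight $-\alpha_b\overline{\alpha_{b-k-1}}\prod_{j=b-k}^{b-1}(1-|\alpha_j|^2)$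 (the empty product being $1$). -}

module Defs where

open import Algebra.Bundles using (CommutativeRing)
open import Algebra.Bundles.Raw using (RawRing)
open import Algebra.Module.Bundles.Raw using (RawLeftModule)
import Algebra.Module.Construct.TensorUnit as TensorUnit
import Algebra.Module.Morphism.Structures as ModuleMorphisms
import Algebra.Properties.CommutativeSemigroup as CommutativeSemigroupProperties
import Algebra.Properties.Ring as RingProperties
open import Data.Bool.Base using (if_then_else_)
open import Data.Empty using (⊥-elim)
open import Data.Integer.Base as ℤ using (ℤ; +_)
import Data.Integer.Properties as ℤ
open import Data.List.Base as List
  using (List; []; _∷_; [_]; _++_; map; foldr; concatMap; cartesianProductWith; upTo; head; last)
open import Data.List.Membership.Propositional using (_∈_; find; lose)
import Data.List.Membership.Propositional.Properties as ∈
import Data.List.Properties as List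
open import Data.List.Relation.Binary.Disjoint.Propositional using (Disjoint)
open import Data.List.Relation.Unary.All as All using (All; []; _∷_)
import Data.List.Relation.Unary.All.Properties as All
open import Data.List.Relation.Unary.AllPairs as AllPairs using ([]; _∷_)
import Data.List.Relation.Unary.AllPairs.Properties as AllPairs
open import Data.List.Relation.Unary.Any using (here; there)
open import Data.List.Relation.Unary.Linked using (Linked; []; [-]; _∷_)
open import Data.List.Relation.Unary.Unique.Propositional using (Unique)
import Data.List.Relation.Unary.Unique.Propositional.Properties as Unique
open import Data.Maybe.Base using (just)
open import Data.Maybe.Properties using (just-injective)
open import Data.Nat.Base as ℕ using (ℕ; zero; suc; s≤s)
import Data.Nat.Properties as ℕ
open import Data.Product.Base using (Σ; ∃-syntax; _×_; _,_; proj₁; proj₂)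
open import Data.Product.Properties using (,-injective)
open import Data.Rational.Base as ℚ using (ℚ; 0ℚ; 1ℚ; ½)
import Data.Rational.Properties as ℚ
open import Function.Base using (_∘_)
open import Function.Bundles using (_⇔_; mk⇔)
open import Level using (0ℓ)
open import Relation.Binary.PropositionalEquality
  using (_≡_; _≢_; refl; sym; trans; cong; cong₂; subst; subst₂)
open import Relation.Nullary using (¬_; does; yes; no)
open import Relation.Unary using (Pred)

-- Real numbers: Cauchy sequences of rationals, with the usual
-- equivalence as setoid equality.

Eventually : Pred ℕ 0ℓ → Set
Eventually P = ∃[ N ] ∀ n → N ℕ.≤ n → P n

IsCauchy : (ℕ → ℚ) → Set
IsCauchy x = ∀ ε → 0ℚ ℚ.< ε →
  ∃[ N ] ∀ m n → N ℕ.≤ m → N ℕ.≤ n → ℚ.∣ x m ℚ.- x n ∣ ℚ.< ε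

record ℝ : Set where
  constructor mkℝ
  field
    seq    : ℕ → ℚ
    cauchy : IsCauchy seq

open ℝ public

infix 4 _≈ᴿ_ _<ᴿ_ _≤ᴿ_

_≈ᴿ_ : ℝ → ℝ → Set
x ≈ᴿ y = ∀ ε → 0ℚ ℚ.< ε → Eventually λ n → ℚ.∣ seq x n ℚ.- seq y n ∣ ℚ.< ε

_<ᴿ_ : ℝ → ℝ → Set
x <ᴿ y = ∃[ ε ] 0ℚ ℚ.< ε × Eventually λ n → seq x n ℚ.+ ε ℚ.≤ seq y n

_≤ᴿ_ : ℝ → ℝ → Set
x ≤ᴿ y = ¬ (y <ᴿ x)

private
  module ℚ-ring = RingProperties (CommutativeRing.ring ℚ.+-*-commutativeRing)
  module ℚ-+ = CommutativeSemigroupProperties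
                 (CommutativeRing.+-commutativeSemigroup ℚ.+-*-commutativeRing)
  module ℚ-* = CommutativeSemigroupProperties
                 (CommutativeRing.*-commutativeSemigroup ℚ.+-*-commutativeRing)

  abstract
    half-pos : ∀ {ε} → 0ℚ ℚ.< ε → 0ℚ ℚ.< ½ ℚ.* ε
    half-pos {ε} p = ℚ.positive⁻¹ _ {{ℚ.pos*pos⇒pos ½ ε {{ℚ.positive p}}}}

    halves : ∀ ε → ½ ℚ.* ε ℚ.+ ½ ℚ.* ε ≡ ε
    halves ε = trans (sym (ℚ.*-distribʳ-+ ε ½ ½)) (ℚ.*-identityˡ ε)

    ∣-∣-swap : ∀ p q → ℚ.∣ p ℚ.- q ∣ ≡ ℚ.∣ q ℚ.- p ∣
    ∣-∣-swap p q = trans (sym (ℚ.∣-p∣≡∣p∣ (p ℚ.- q)))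
      (cong ℚ.∣_∣ (ℚ-ring.⁻¹-anti-homo‿- p q))

    telescope : ∀ a b c → (a ℚ.- b) ℚ.+ (b ℚ.- c) ≡ a ℚ.- c
    telescope a b c = trans (sym (ℚ.+-assoc (a ℚ.- b) b (ℚ.- c)))
      (cong (ℚ._- c) (ℚ-ring.//-rightDividesˡ b a))

    *-mono-≤-nonNeg : ∀ {a b c d} → 0ℚ ℚ.≤ c → 0ℚ ℚ.≤ b → a ℚ.≤ b → c ℚ.≤ d →
                      a ℚ.* c ℚ.≤ b ℚ.* d
    *-mono-≤-nonNeg {a} {b} {c} {d} 0≤c 0≤b a≤b c≤d = ℚ.≤-trans
      (ℚ.*-monoʳ-≤-nonNeg c {{ℚ.nonNegative 0≤c}} a≤b)
      (ℚ.*-monoˡ-≤-nonNeg b {{ℚ.nonNegative 0≤b}} c≤d)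

    constant : ∀ q → IsCauchy (λ _ → q)
    constant q ε 0<ε = 0 , λ _ _ _ _ → subst (λ d → ℚ.∣ d ∣ ℚ.< ε) (sym (ℚ.+-inverseʳ q)) 0<ε

    negate : ∀ x → IsCauchy x → IsCauchy (λ n → ℚ.- x n)
    negate x cx ε 0<ε with cx ε 0<ε
    ... | N , close = N , λ m n N≤m N≤n → subst (ℚ._< ε)
          (trans (∣-∣-swap (x m) (x n))
            (cong ℚ.∣_∣ (trans (ℚ.+-comm (x n) (ℚ.- x m))
              (cong (ℚ.- x m ℚ.+_) (sym (ℚ-ring.-‿involutive (x n)))))))
          (close m n N≤m N≤n)

    plus : ∀ x y → IsCauchy x → IsCauchy y → IsCauchy (λ n → x n ℚ.+ y n)
    plus x y cx cy ε 0<ε with cx (½ ℚ.* ε) (half-pos 0<ε) | cy (½ ℚ.* ε) (half-pos 0<ε)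
    ... | M , closeˣ | N , closeʸ = M ℕ.⊔ N , λ m n p q → subst₂ ℚ._<_
          (cong ℚ.∣_∣ (regroup m n)) (halves ε)
          (ℚ.≤-<-trans (ℚ.∣p+q∣≤∣p∣+∣q∣ (x m ℚ.- x n) (y m ℚ.- y n))
            (ℚ.+-mono-< (closeˣ m n (ℕ.m⊔n≤o⇒m≤o M N p) (ℕ.m⊔n≤o⇒m≤o M N q))
                        (closeʸ m n (ℕ.m⊔n≤o⇒n≤o M N p) (ℕ.m⊔n≤o⇒n≤o M N q))))
      where
      regroup : ∀ m n → (x m ℚ.- x n) ℚ.+ (y m ℚ.- y n) ≡ (x m ℚ.+ y m) ℚ.- (x n ℚ.+ y n)
      regroup m n = trans (ℚ-+.interchange (x m) (ℚ.- x n) (y m) (ℚ.- y n))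
        (cong (x m ℚ.+ y m ℚ.+_) (sym (ℚ.neg-distrib-+ (x n) (y n))))

    bounded : ∀ x → IsCauchy x → ∃[ K ] 0ℚ ℚ.< K × Eventually λ n → ℚ.∣ x n ∣ ℚ.≤ K
    bounded x cx with cx 1ℚ (ℚ.positive⁻¹ 1ℚ)
    ... | N , close = 1ℚ ℚ.+ ℚ.∣ x N ∣ , positive , N , bound
      where
      positive : 0ℚ ℚ.< 1ℚ ℚ.+ ℚ.∣ x N ∣
      positive = ℚ.+-mono-<-≤ (ℚ.positive⁻¹ 1ℚ) (ℚ.0≤∣p∣ (x N))

      bound : ∀ n → N ℕ.≤ n → ℚ.∣ x n ∣ ℚ.≤ 1ℚ ℚ.+ ℚ.∣ x N ∣
      bound n N≤n = ℚ.≤-trans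
        (subst (λ q → ℚ.∣ q ∣ ℚ.≤ ℚ.∣ x n ℚ.- x N ∣ ℚ.+ ℚ.∣ x N ∣)
          (ℚ-ring.//-rightDividesˡ (x N) (x n))
          (ℚ.∣p+q∣≤∣p∣+∣q∣ (x n ℚ.- x N) (x N)))
        (ℚ.+-monoˡ-≤ ℚ.∣ x N ∣ (ℚ.<⇒≤ (close n N N≤n ℕ.≤-refl)))

    scaled : ∀ K x → 0ℚ ℚ.< K → IsCauchy x → ∀ ε → 0ℚ ℚ.< ε →
             ∃[ N ] ∀ m n → N ℕ.≤ m → N ℕ.≤ n → K ℚ.* ℚ.∣ x m ℚ.- x n ∣ ℚ.< ε
    scaled K x 0<K cx ε 0<ε = proj₁ close , λ m n p q →
      subst (K ℚ.* ℚ.∣ x m ℚ.- x n ∣ ℚ.<_) K*ε/K≡ε (ℚ.*-monoʳ-<-pos K (proj₂ close m n p q))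
      where
      instance
        K-pos : ℚ.Positive K
        K-pos = ℚ.positive 0<K
        K-nonZero : ℚ.NonZero K
        K-nonZero = ℚ.pos⇒nonZero K

      0<ε/K : 0ℚ ℚ.< ℚ.1/ K ℚ.* ε
      0<ε/K = ℚ.positive⁻¹ _ {{ℚ.pos*pos⇒pos (ℚ.1/ K) {{ℚ.1/pos⇒pos K}} ε {{ℚ.positive 0<ε}}}}

      K*ε/K≡ε : K ℚ.* (ℚ.1/ K ℚ.* ε) ≡ ε
      K*ε/K≡ε = trans (sym (ℚ.*-assoc K (ℚ.1/ K) ε))
        (trans (cong (ℚ._* ε) (ℚ.*-inverseʳ K)) (ℚ.*-identityˡ ε))

      close : ∃[ N ] ∀ m n → N ℕ.≤ m → N ℕ.≤ n → ℚ.∣ x m ℚ.- x n ∣ ℚ.< ℚ.1/ K ℚ.* ε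
      close = cx (ℚ.1/ K ℚ.* ε) 0<ε/K

    product-bound : ∀ B ε a d → ℚ.∣ a ∣ ℚ.≤ B → B ℚ.* ℚ.∣ d ∣ ℚ.< ε → ℚ.∣ a ℚ.* d ∣ ℚ.< ε
    product-bound B ε a d a≤B Bd<ε = ℚ.≤-<-trans (ℚ.≤-reflexive (ℚ.∣p*q∣≡∣p∣*∣q∣ a d))
      (ℚ.≤-<-trans (ℚ.*-monoʳ-≤-nonNeg ℚ.∣ d ∣ {{ℚ.∣-∣-nonNeg d}} a≤B) Bd<ε)

    product-close : ∀ a b c d ε →
                    ℚ.∣ a ℚ.* (c ℚ.- d) ∣ ℚ.< ½ ℚ.* ε → ℚ.∣ d ℚ.* (a ℚ.- b) ∣ ℚ.< ½ ℚ.* ε →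
                    ℚ.∣ a ℚ.* c ℚ.- b ℚ.* d ∣ ℚ.< ε
    product-close a b c d ε p q = subst₂ ℚ._<_ (cong ℚ.∣_∣ regroup) (halves ε)
      (ℚ.≤-<-trans (ℚ.∣p+q∣≤∣p∣+∣q∣ (a ℚ.* (c ℚ.- d)) (d ℚ.* (a ℚ.- b))) (ℚ.+-mono-< p q))
      where
      regroup : a ℚ.* (c ℚ.- d) ℚ.+ d ℚ.* (a ℚ.- b) ≡ a ℚ.* c ℚ.- b ℚ.* d
      regroup = trans
        (cong₂ ℚ._+_ (ℚ-ring.x[y-z]≈xy-xz a c d)
          (trans (ℚ.*-comm d (a ℚ.- b)) (ℚ-ring.[y-z]x≈yx-zx d a b)))
        (telescope (a ℚ.* c) (a ℚ.* d) (b ℚ.* d))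

    times : ∀ x y → IsCauchy x → IsCauchy y → IsCauchy (λ n → x n ℚ.* y n)
    times x y cx cy ε 0<ε =
      let K , 0<K , M , x≤K = bounded x cx
          L , 0<L , N , y≤L = bounded y cy
          P , closeʸ = scaled K y 0<K cy (½ ℚ.* ε) (half-pos 0<ε)
          Q , closeˣ = scaled L x 0<L cx (½ ℚ.* ε) (half-pos 0<ε)
      in (M ℕ.⊔ N) ℕ.⊔ (P ℕ.⊔ Q) , λ m n p q →
        let MN≤m = ℕ.m⊔n≤o⇒m≤o (M ℕ.⊔ N) (P ℕ.⊔ Q) p
            MN≤n = ℕ.m⊔n≤o⇒m≤o (M ℕ.⊔ N) (P ℕ.⊔ Q) q
            PQ≤m = ℕ.m⊔n≤o⇒n≤o (M ℕ.⊔ N) (P ℕ.⊔ Q) p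
            PQ≤n = ℕ.m⊔n≤o⇒n≤o (M ℕ.⊔ N) (P ℕ.⊔ Q) q
        in product-close (x m) (x n) (y m) (y n) ε
          (product-bound K (½ ℚ.* ε) (x m) (y m ℚ.- y n) (x≤K m (ℕ.m⊔n≤o⇒m≤o M N MN≤m))
            (closeʸ m n (ℕ.m⊔n≤o⇒m≤o P Q PQ≤m) (ℕ.m⊔n≤o⇒m≤o P Q PQ≤n)))
          (product-bound L (½ ℚ.* ε) (y n) (x m ℚ.- x n) (y≤L n (ℕ.m⊔n≤o⇒n≤o M N MN≤n))
            (closeˣ m n (ℕ.m⊔n≤o⇒n≤o P Q PQ≤m) (ℕ.m⊔n≤o⇒n≤o P Q PQ≤n)))

infix  8 -ᴿ_
infixl 7 _*ᴿ_
infixl 6 _+ᴿ_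

0ᴿ 1ᴿ : ℝ
0ᴿ = mkℝ (λ _ → 0ℚ) (constant 0ℚ)
1ᴿ = mkℝ (λ _ → 1ℚ) (constant 1ℚ)

_+ᴿ_ : ℝ → ℝ → ℝ
x +ᴿ y = mkℝ (λ n → seq x n ℚ.+ seq y n) (plus (seq x) (seq y) (cauchy x) (cauchy y))

_*ᴿ_ : ℝ → ℝ → ℝ
x *ᴿ y = mkℝ (λ n → seq x n ℚ.* seq y n) (times (seq x) (seq y) (cauchy x) (cauchy y))

-ᴿ_ : ℝ → ℝ
-ᴿ x = mkℝ (λ n → ℚ.- seq x n) (negate (seq x) (cauchy x))

-- The terms of a positive real are eventually at least some rational
-- δ > 0. Replacing the finitely many exceptional terms by their maximum
-- with δ makes every term invertible without changing the real number.

module Inverse (x : ℝ) (x>0 : 0ᴿ <ᴿ x) where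

  δ : ℚ
  δ = proj₁ x>0

  0<δ : 0ℚ ℚ.< δ
  0<δ = proj₁ (proj₂ x>0)

  term : ℕ → ℚ
  term n = seq x n ℚ.⊔ δ

  δ≤term : ∀ n → δ ℚ.≤ term n
  δ≤term n = ℚ.p≤q⊔p (seq x n) δ

  instance
    δ-pos : ℚ.Positive δ
    δ-pos = ℚ.positive 0<δ

    δ-nonZero : ℚ.NonZero δ
    δ-nonZero = ℚ.pos⇒nonZero δ

    term-pos : ∀ {n} → ℚ.Positive (term n)
    term-pos {n} = ℚ.positive (ℚ.<-≤-trans 0<δ (δ≤term n))

    term-nonZero : ∀ {n} → ℚ.NonZero (term n)
    term-nonZero {n} = ℚ.pos⇒nonZero (term n)

  inverseTerm : ℕ → ℚ
  inverseTerm n = ℚ.1/ term n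

  private
    D : ℚ
    D = ℚ.1/ δ

    0≤D : 0ℚ ℚ.≤ D
    0≤D = ℚ.<⇒≤ (ℚ.positive⁻¹ D {{ℚ.1/pos⇒pos δ}})

    0≤inverseTerm : ∀ n → 0ℚ ℚ.≤ inverseTerm n
    0≤inverseTerm n = ℚ.<⇒≤ (ℚ.positive⁻¹ (inverseTerm n) {{ℚ.1/pos⇒pos (term n)}})

    abstract
      inverseTerm≤D : ∀ n → inverseTerm n ℚ.≤ D
      inverseTerm≤D n = subst₂ ℚ._≤_ lhs rhs
        (*-mono-≤-nonNeg {δ} {term n} {inverseTerm n ℚ.* D}
          (subst (ℚ._≤ inverseTerm n ℚ.* D) (ℚ.*-zeroʳ 0ℚ)
            (*-mono-≤-nonNeg ℚ.≤-refl (0≤inverseTerm n) (0≤inverseTerm n) 0≤D))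
          (ℚ.<⇒≤ (ℚ.positive⁻¹ (term n))) (δ≤term n) ℚ.≤-refl)
        where
        lhs : δ ℚ.* (inverseTerm n ℚ.* D) ≡ inverseTerm n
        lhs = trans (ℚ-*.x∙yz≈xz∙y δ (inverseTerm n) D)
          (trans (cong (ℚ._* inverseTerm n) (ℚ.*-inverseʳ δ)) (ℚ.*-identityˡ _))
        rhs : term n ℚ.* (inverseTerm n ℚ.* D) ≡ D
        rhs = trans (sym (ℚ.*-assoc (term n) (inverseTerm n) D))
          (trans (cong (ℚ._* D) (ℚ.*-inverseʳ (term n))) (ℚ.*-identityˡ D))

      difference : ∀ m n → (inverseTerm m ℚ.* inverseTerm n) ℚ.* (term n ℚ.- term m)
                         ≡ inverseTerm m ℚ.- inverseTerm n
      difference m n = trans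
        (ℚ-ring.x[y-z]≈xy-xz (inverseTerm m ℚ.* inverseTerm n) (term n) (term m))
        (cong₂ ℚ._-_ cancelⁿ cancelᵐ)
        where
        cancelⁿ : inverseTerm m ℚ.* inverseTerm n ℚ.* term n ≡ inverseTerm m
        cancelⁿ = trans (ℚ.*-assoc (inverseTerm m) (inverseTerm n) (term n))
          (trans (cong (inverseTerm m ℚ.*_) (ℚ.*-inverseˡ (term n)))
            (ℚ.*-identityʳ (inverseTerm m)))

        cancelᵐ : inverseTerm m ℚ.* inverseTerm n ℚ.* term m ≡ inverseTerm n
        cancelᵐ = trans (ℚ-*.xy∙z≈xz∙y (inverseTerm m) (inverseTerm n) (term m))
          (trans (cong (ℚ._* inverseTerm n) (ℚ.*-inverseˡ (term m)))
            (ℚ.*-identityˡ (inverseTerm n)))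

      product≤ : ∀ m n → ℚ.∣ inverseTerm m ℚ.* inverseTerm n ∣ ℚ.≤ D ℚ.* D
      product≤ m n = ℚ.≤-trans
        (ℚ.≤-reflexive (trans (ℚ.∣p*q∣≡∣p∣*∣q∣ (inverseTerm m) (inverseTerm n))
          (cong₂ ℚ._*_ (ℚ.0≤p⇒∣p∣≡p (0≤inverseTerm m)) (ℚ.0≤p⇒∣p∣≡p (0≤inverseTerm n)))))
        (*-mono-≤-nonNeg (0≤inverseTerm n) 0≤D (inverseTerm≤D m) (inverseTerm≤D n))

      0<D*D : 0ℚ ℚ.< D ℚ.* D
      0<D*D = ℚ.positive⁻¹ _ {{ℚ.pos*pos⇒pos D {{ℚ.1/pos⇒pos δ}} D {{ℚ.1/pos⇒pos δ}}}}

      lipschitz : ∀ m n → ℚ.∣ inverseTerm m ℚ.- inverseTerm n ∣ ℚ.≤ D ℚ.* D ℚ.* ℚ.∣ term m ℚ.- term n ∣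
      lipschitz m n = ℚ.≤-trans
        (ℚ.≤-reflexive (trans (cong ℚ.∣_∣ (sym (difference m n)))
          (ℚ.∣p*q∣≡∣p∣*∣q∣ (inverseTerm m ℚ.* inverseTerm n) (term n ℚ.- term m))))
        (ℚ.≤-trans
          (ℚ.*-monoʳ-≤-nonNeg ℚ.∣ term n ℚ.- term m ∣ {{ℚ.∣-∣-nonNeg (term n ℚ.- term m)}} (product≤ m n))
          (ℚ.≤-reflexive (cong (D ℚ.* D ℚ.*_) (∣-∣-swap (term n) (term m)))))

  abstract
    isCauchy : IsCauchy inverseTerm
    isCauchy ε 0<ε = M ℕ.⊔ proj₁ scaled-x , λ m n p q → ℚ.≤-<-trans (lipschitz m n)
      (subst₂ (λ a b → D ℚ.* D ℚ.* ℚ.∣ a ℚ.- b ∣ ℚ.< ε)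
        (sym (unchanged m (ℕ.m⊔n≤o⇒m≤o M (proj₁ scaled-x) p))) (sym (unchanged n (ℕ.m⊔n≤o⇒m≤o M (proj₁ scaled-x) q)))
        (proj₂ scaled-x m n (ℕ.m⊔n≤o⇒n≤o M (proj₁ scaled-x) p) (ℕ.m⊔n≤o⇒n≤o M (proj₁ scaled-x) q)))
      where
      M : ℕ
      M = proj₁ (proj₂ (proj₂ x>0))

      scaled-x : ∃[ N ] ∀ m n → N ℕ.≤ m → N ℕ.≤ n → D ℚ.* D ℚ.* ℚ.∣ seq x m ℚ.- seq x n ∣ ℚ.< ε
      scaled-x = scaled (D ℚ.* D) (seq x) 0<D*D (cauchy x) ε 0<ε

      unchanged : ∀ n → M ℕ.≤ n → term n ≡ seq x n
      unchanged n M≤n = ℚ.p≥q⇒p⊔q≡p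
        (subst (ℚ._≤ seq x n) (ℚ.+-identityˡ δ) (proj₂ (proj₂ (proj₂ x>0)) n M≤n))

inverseᴿ : (x : ℝ) → 0ᴿ <ᴿ x → ℝ
inverseᴿ x x>0 = mkℝ (Inverse.inverseTerm x x>0) (Inverse.isCauchy x x>0)

record ℂ : Set where
  constructor _+i_
  field
    re im : ℝ

open ℂ public

infix  8 -_
infixl 7 _*_ _/_
infixl 6 _+_ _-_
infix  4 _≈_ _≉0

_≈_ : ℂ → ℂ → Set
w ≈ z = re w ≈ᴿ re z × im w ≈ᴿ im z

ofReal : ℝ → ℂ
ofReal x = x +i 0ᴿ

0ᶜ 1ᶜ : ℂ
0ᶜ = ofReal 0ᴿ
1ᶜ = ofReal 1ᴿ

_+_ _*_ : ℂ → ℂ → ℂ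
w + z = (re w +ᴿ re z) +i (im w +ᴿ im z)
w * z = (re w *ᴿ re z +ᴿ -ᴿ (im w *ᴿ im z)) +i (re w *ᴿ im z +ᴿ im w *ᴿ re z)

-_ : ℂ → ℂ
-_ z = (-ᴿ re z) +i (-ᴿ im z)

_-_ : ℂ → ℂ → ℂ
w - z = w + (- z)

conj : ℂ → ℂ
conj z = re z +i (-ᴿ im z)

∣_∣² : ℂ → ℝ
∣ z ∣² = re z *ᴿ re z +ᴿ im z *ᴿ im z

-- r is the modulus √(re² + im²) of z.
IsModulus : ℂ → ℝ → Set
IsModulus z r = 0ᴿ ≤ᴿ r × r *ᴿ r ≈ᴿ ∣ z ∣²

∣_∣<_ : ℂ → ℝ → Set
∣ z ∣< t = ∃[ r ] IsModulus z r × r <ᴿ t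

-- Being nonzero in the positive sense (apartness from 0), as division of
-- Cauchy reals requires.
_≉0 : ℂ → Set
z ≉0 = 0ᴿ <ᴿ ∣ z ∣²

_/_ : ℂ → (z : ℂ) → {z ≉0} → ℂ
(w / z) {z≉0} = w * conj z * ofReal (inverseᴿ ∣ z ∣² z≉0)

∑ ∏ : List ℂ → ℂ
∑ = foldr _+_ 0ᶜ
∏ = foldr _*_ 1ᶜ

ℂ-rawRing : RawRing 0ℓ 0ℓ
ℂ-rawRing = record
  { Carrier = ℂ ; _≈_ = _≈_ ; _+_ = _+_ ; _*_ = _*_ ; -_ = -_ ; 0# = 0ᶜ ; 1# = 1ᶜ }

-- Laurent polynomials: the list of the pairs (k , c) stands for the sum
-- of the monomials c zᵏ. Exponents may repeat and coefficients may be
-- zero, so equality compares total coefficients.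

Laurent : Set
Laurent = List (ℤ × ℂ)

coefficient : ℤ → Laurent → ℂ
coefficient k f = ∑ (map (λ (l , c) → if does (k ℤ.≟ l) then c else 0ᶜ) f)

infix  8 _~
infixr 7 _·ᴸ_
infixl 7 _*ᴸ_
infixl 6 _+ᴸ_ _-ᴸ_
infix  4 _≈ᴸ_

_≈ᴸ_ : Laurent → Laurent → Set
f ≈ᴸ g = ∀ k → coefficient k f ≈ coefficient k g

z^_ : ℤ → Laurent
z^ k = [ (k , 1ᶜ) ]

_+ᴸ_ _*ᴸ_ : Laurent → Laurent → Laurent
f +ᴸ g = f ++ g
f *ᴸ g = cartesianProductWith (λ (k , c) (l , d) → (k ℤ.+ l , c * d)) f g

_·ᴸ_ : ℂ → Laurent → Laurent
c ·ᴸ f = map (λ (k , d) → (k , c * d)) f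

-ᴸ_ : Laurent → Laurent
-ᴸ_ f = map (λ (k , c) → (k , - c)) f

_-ᴸ_ : Laurent → Laurent → Laurent
f -ᴸ g = f +ᴸ (-ᴸ g)

-- f ~ is f̄(1/z).
_~ : Laurent → Laurent
f ~ = map (λ (k , c) → (ℤ.- k , conj c)) f

laurentModule : RawLeftModule ℂ 0ℓ 0ℓ
laurentModule = record
  { Carrierᴹ = Laurent ; _≈ᴹ_ = _≈ᴸ_ ; _+ᴹ_ = _+ᴸ_ ; _*ₗ_ = _·ᴸ_ ; 0ᴹ = [] ; -ᴹ_ = -ᴸ_ }

IsLinear : (Laurent → ℂ) → Set
IsLinear = IsLeftModuleHomomorphism
  where open ModuleMorphisms.LeftModuleMorphisms
               laurentModule (TensorUnit.rawLeftModule {R = ℂ-rawRing})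

-- zⁿ f̄(1/z), which is f* for f a polynomial of degree n.
reversed : ℕ → Laurent → Laurent
reversed n f = z^ (+ n) *ᴸ f ~

Φ : (ℕ → ℂ) → ℕ → Laurent
Φ α zero    = z^ (+ 0)
Φ α (suc n) = z^ (+ 1) *ᴸ Φ α n -ᴸ conj (α n) ·ᴸ reversed n (Φ α n)

⟨_,_⟩[_] : Laurent → Laurent → (Laurent → ℂ) → ℂ
⟨ f , g ⟩[ 𝓛 ] = 𝓛 (f *ᴸ g ~)

-- Linearity, normalization and orthogonality determine 𝓛 uniquely.
record IsMomentFunctional (α : ℕ → ℂ) (𝓛 : Laurent → ℂ) : Set where
  field
    linear     : IsLinear 𝓛
    normalized : 𝓛 (z^ (+ 0)) ≈ 1ᶜ
    orthogonal : ∀ m n → m ≢ n → ⟨ Φ α m , Φ α n ⟩[ 𝓛 ] ≈ 0ᶜ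

μ : (α : ℕ → ℂ) (𝓛 : Laurent → ℂ) (n r s : ℕ) → ⟨ Φ α s , Φ α s ⟩[ 𝓛 ] ≉0 → ℂ
μ α 𝓛 n r s nonzero =
  (⟨ Φ α s , z^ (+ n) *ᴸ Φ α r ⟩[ 𝓛 ] / ⟨ Φ α s , Φ α s ⟩[ 𝓛 ]) {nonzero}

Point : Set
Point = ℤ × ℕ

-- A step (1 , k) with k = b′ - b ≤ 1.
Step : Point → Point → Set
Step (a , b) (a′ , b′) = a′ ≡ ℤ.suc a × b′ ℕ.≤ suc b

record 𝔏 (n r s : ℕ) (p : List Point) : Set where
  constructor mk𝔏
  field
    steps : Linked Step p
    start : head p ≡ just (+ 0 , r)
    end   : last p ≡ just (+ n , s)

-- before α j is αⱼ₋₁, with α₋₁ = -1.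
before : (ℕ → ℂ) → ℕ → ℂ
before α zero    = - 1ᶜ
before α (suc j) = α j

-- In a step that is not an up-step, the end height b′ is b - k.
stepWeight : (ℕ → ℂ) → Point → Point → ℂ
stepWeight α (_ , b) (_ , b′) = if does (b′ ℕ.≟ suc b) then 1ᶜ else
  - α b * conj (before α b′) *
  ∏ (map (λ i → 1ᶜ - ofReal ∣ α (b′ ℕ.+ i) ∣²) (upTo (b ℕ.∸ b′)))

wt : (ℕ → ℂ) → List Point → ℂ
wt α []          = 1ᶜ
wt α (_ ∷ [])    = 1ᶜ
wt α (P ∷ Q ∷ p) = stepWeight α P Q * wt α (Q ∷ p)

record Enumeration {A : Set} (P : Pred A 0ℓ) : Set where
  field
    list     : List A
    unique   : Unique list
    complete : ∀ x → x ∈ list ⇔ P x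

∑[_] : ∀ {A : Set} {P : Pred A 0ℓ} → Enumeration P → (A → ℂ) → ℂ
∑[ E ] f = ∑ (map f (Enumeration.list E))

-- All paths from (k , r) to (k + n , s).
pathsFrom : (k n r s : ℕ) → List (List Point)
pathsFrom k zero r s with r ℕ.≟ s
... | yes _ = [ [ (+ k , r) ] ]
... | no  _ = []
pathsFrom k (suc n) r s =
  map ((+ k , r) ∷_) (concatMap (λ b → pathsFrom (suc k) n b s) (upTo (2 ℕ.+ r)))

private
  Joins : ℕ → ℕ → ℕ → ℕ → Pred (List Point) 0ℓ
  Joins k n r s p =
    Linked Step p × head p ≡ just (+ k , r) × last p ≡ just (+ (k ℕ.+ n) , s)

  later : ∀ {k m r s p} → Linked Step p → head p ≡ just (+ k , r) → last p ≡ just (+ m , s) → k ℕ.≤ m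
  later [-] refl refl = ℕ.≤-refl
  later ((refl , _) ∷ l) refl e = ℕ.≤-trans (ℕ.n≤1+n _) (later l refl e)

  sound : ∀ k n r s {p} → p ∈ pathsFrom k n r s → Joins k n r s p
  sound k zero r s p∈ with r ℕ.≟ s
  sound k zero r .r (here refl) | yes refl =
    [-] , refl , cong (λ m → just (+ m , r)) (sym (ℕ.+-identityʳ k))
  sound k (suc n) r s p∈ with ∈.∈-map⁻ _ p∈
  ... | q , q∈ , refl with find (∈.∈-concatMap⁻ (λ b → pathsFrom (suc k) n b s) {xs = upTo (2 ℕ.+ r)} q∈)
  ... | b , b∈ , q∈′ = extend (sound (suc k) n b s q∈′)
    where
    extend : ∀ {q} → Joins (suc k) n b s q → Joins k (suc n) r s ((+ k , r) ∷ q)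
    extend {_ ∷ _} (l , refl , e) =
      (refl , ℕ.≤-pred (∈.∈-upTo⁻ b∈)) ∷ l , refl ,
      trans e (cong (λ m → just (+ m , s)) (sym (ℕ.+-suc k n)))

  complete : ∀ k n r s {p} → Joins k n r s p → p ∈ pathsFrom k n r s
  complete k zero r s ([-] , refl , e) with r ℕ.≟ s
  ... | yes _  = here refl
  ... | no r≢s = ⊥-elim (r≢s (proj₂ (,-injective (just-injective e))))
  complete k zero r s ((refl , _) ∷ l , refl , e) =
    ⊥-elim (ℕ.<-irrefl refl (subst (suc k ℕ.≤_) (ℕ.+-identityʳ k) (later l refl e)))
  complete k (suc n) r s ([-] , refl , e) =
    ⊥-elim (ℕ.m≢1+m+n k (trans (ℤ.+-injective (proj₁ (,-injective (just-injective e)))) (ℕ.+-suc k n)))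
  complete k (suc n) r s (_∷_ {y = _ , b} (refl , b≤) l , refl , e) =
    ∈.∈-map⁺ _ (∈.∈-concatMap⁺ (λ b → pathsFrom (suc k) n b s)
      (lose (∈.∈-upTo⁺ (s≤s b≤))
        (complete (suc k) n b s (l , refl , trans e (cong (λ m → just (+ m , s)) (ℕ.+-suc k n))))))

  unique : ∀ k n r s → Unique (pathsFrom k n r s)
  unique k zero r s with r ℕ.≟ s
  ... | yes _ = [] ∷ []
  ... | no  _ = []
  unique k (suc n) r s = Unique.map⁺ List.∷-injectiveʳ
    (Unique.concat⁺
      (All.map⁺ (All.tabulate λ {b} _ → unique (suc k) n b s))
      (AllPairs.map⁺ (AllPairs.map disjoint (Unique.upTo⁺ (2 ℕ.+ r)))))
    where
    disjoint : ∀ {b c} → b ≢ c → Disjoint (pathsFrom (suc k) n b s) (pathsFrom (suc k) n c s)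
    disjoint {b} {c} b≢c (p∈b , p∈c) = b≢c (proj₂ (,-injective (just-injective
      (trans (sym (proj₁ (proj₂ (sound (suc k) n b s p∈b)))) (proj₁ (proj₂ (sound (suc k) n c s p∈c)))))))

𝔏-enumeration : ∀ n r s → Enumeration (𝔏 n r s)
𝔏-enumeration n r s = record
  { list     = pathsFrom 0 n r s
  ; unique   = unique 0 n r s
  ; complete = λ p → mk⇔
      (λ p∈ → let l , h , e = sound 0 n r s p∈ in mk𝔏 l h e)
      (λ (mk𝔏 l h e) → complete 0 n r s (l , h , e))
  }

{-# OPTIONS --safe #-}

-- Fix s and put Aₙ(r) = ⟨Φₛ , zⁿ Φᵣ⟩ and Bₙ(r) = ⟨Φₛ , zⁿ Φᵣ*⟩. The recursions
-- zΦᵣ = Φᵣ₊₁ + ᾱᵣ Φᵣ* and Φᵣ₊₁* = (1 - |αᵣ|²) Φᵣ* - αᵣ Φᵣ₊₁ become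
--   Aₙ₊₁(r) = Aₙ(r+1) + αᵣ Bₙ(r),  Bₙ(r+1) = (1 - |αᵣ|²) Bₙ(r) - ᾱᵣ Aₙ(r+1).
-- Unrolling the second, with α₋₁ = -1, writes Bₙ(r) as a combination of Aₙ(b) for
-- b ≤ r, and the first then says that Aₙ₊₁(r) is the sum of Aₙ(b) over the steps
-- r → b, with the weights of the theorem. Since A₀(r) = δᵣₛ ⟨Φₛ , Φₛ⟩, the claim
-- follows by induction on n. The norms are nonzero because multiplication by z is
-- an isometry and ⟨Φ* , Φ*⟩ = ⟨Φ , Φ⟩, so ⟨Φₙ₊₁ , Φₙ₊₁⟩ = (1 - |αₙ|²) ⟨Φₙ , Φₙ⟩.
-- Laurent polynomials are compared only through their values under functionals
-- z^k ↦ m k, which replaces convolution of coefficients by exchanging two sums.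
module Submission where

open import Defs hiding (_+_; _*_; -_; _-_; _/_; _≈_)
import Defs as ℂ
open import Algebra.Bundles using (CommutativeRing)
import Algebra.Module.Morphism.Structures as ModuleMorphisms
import Algebra.Properties.Ring as RingProperties
import Algebra.Solver.Ring.NaturalCoefficients.Default as SemiringSolver
open import Data.Bool.Base using (Bool; true; false; if_then_else_)
open import Data.Empty using (⊥-elim)
open import Data.Integer.Base as ℤ using (ℤ; +_)
import Data.Integer.Properties as ℤ
import Data.Integer.Solver as ℤ-Solver
open import Data.List.Base
  using (List; []; _∷_; [_]; _++_; map; foldr; concatMap; upTo; cartesianProductWith)
import Data.List.Properties as List
open import Data.Nat.Base as ℕ using (ℕ; zero; suc)
import Data.Nat.Properties as ℕ
open import Data.Product.Base using (Σ; ∃-syntax; _×_; _,_; proj₂)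
open import Data.Rational.Base as ℚ using (ℚ; 0ℚ; 1ℚ; ½)
import Data.Rational.Properties as ℚ
import Data.Rational.Solver as ℚ-Solver
open import Data.Sum.Base using (inj₁; inj₂)
open import Function.Base using (_∘_)
open import Level using (0ℓ)
import Relation.Binary.PropositionalEquality as ≡
open ≡ using (_≡_; _≢_)
import Relation.Binary.Reasoning.Setoid as SetoidReasoning
open import Relation.Nullary using (does; yes; no)
open import Relation.Nullary.Decidable using (dec-true; dec-false)
open import Relation.Unary using (Pred)

-- Cauchy reals and complex numbers up to null sequences.

module ComplexNumbers where
  open ≡ using (refl; sym; trans; cong; subst; subst₂)
  open ℚ-Solver.+-*-Solver using (solve; _:=_; _:+_; _:*_; :-_; con)

  eventually-∩ : {P Q R : Pred ℕ 0ℓ} → (∀ n → P n → Q n → R n) →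
                 Eventually P → Eventually Q → Eventually R
  eventually-∩ f (M , p) (N , q) =
    M ℕ.⊔ N , λ n le → f n (p n (ℕ.m⊔n≤o⇒m≤o M N le)) (q n (ℕ.m⊔n≤o⇒n≤o M N le))

  eventually-map : {P Q : Pred ℕ 0ℓ} → (∀ n → P n → Q n) → Eventually P → Eventually Q
  eventually-map f (M , p) = M , λ n le → f n (p n le)

  half-positive : ∀ {ε} → 0ℚ ℚ.< ε → 0ℚ ℚ.< ½ ℚ.* ε
  half-positive {ε} p = ℚ.positive⁻¹ _ {{ℚ.pos*pos⇒pos ½ ε {{ℚ.positive p}}}}

  half+half : ∀ ε → ½ ℚ.* ε ℚ.+ ½ ℚ.* ε ≡ ε
  half+half ε = trans (sym (ℚ.*-distribʳ-+ ε ½ ½)) (ℚ.*-identityˡ ε)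

  -- `x ≈ᴿ y` unfolds to `Null` of the difference of the two sequences, so the congruences of the
  -- reals below are closure properties of null sequences.
  Null : (ℕ → ℚ) → Set
  Null d = ∀ ε → 0ℚ ℚ.< ε → Eventually λ n → ℚ.∣ d n ∣ ℚ.< ε

  Bounded : (ℕ → ℚ) → Set
  Bounded b = ∃[ K ] 0ℚ ℚ.< K × Eventually λ n → ℚ.∣ b n ∣ ℚ.≤ K

  null-resp : ∀ {d e} → (∀ n → d n ≡ e n) → Null d → Null e
  null-resp eq d→0 ε 0<ε =
    eventually-map (λ n → subst (λ q → ℚ.∣ q ∣ ℚ.< ε) (eq n)) (d→0 ε 0<ε)

  null-0 : Null (λ _ → 0ℚ)
  null-0 ε 0<ε = 0 , λ _ _ → 0<ε

  null-+ : ∀ {d e} → Null d → Null e → Null (λ n → d n ℚ.+ e n)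
  null-+ {d} {e} d→0 e→0 ε 0<ε = eventually-∩
    (λ n p q → ℚ.≤-<-trans (ℚ.∣p+q∣≤∣p∣+∣q∣ (d n) (e n))
      (subst (ℚ.∣ d n ∣ ℚ.+ ℚ.∣ e n ∣ ℚ.<_) (half+half ε) (ℚ.+-mono-< p q)))
    (d→0 _ (half-positive 0<ε)) (e→0 _ (half-positive 0<ε))

  null-neg : ∀ {d} → Null d → Null (λ n → ℚ.- d n)
  null-neg {d} d→0 ε 0<ε =
    eventually-map (λ n → subst (ℚ._< ε) (sym (ℚ.∣-p∣≡∣p∣ (d n)))) (d→0 ε 0<ε)

  null-* : ∀ {b d} → Bounded b → Null d → Null (λ n → b n ℚ.* d n)
  null-* {b} {d} (K , 0<K , b≤K) d→0 ε 0<ε = eventually-∩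
    (λ n p q → subst₂ ℚ._<_ (sym (ℚ.∣p*q∣≡∣p∣*∣q∣ (b n) (d n))) K*ε/K≡ε
      (ℚ.≤-<-trans (ℚ.*-monoʳ-≤-nonNeg ℚ.∣ d n ∣ {{ℚ.∣-∣-nonNeg (d n)}} p)
        (ℚ.*-monoʳ-<-pos K q)))
    -- Terms of `d` below ε/K suffice, since K (ε/K) = ε.
    b≤K (d→0 (ℚ.1/ K ℚ.* ε) 0<ε/K)
    where
    instance
      K-pos : ℚ.Positive K
      K-pos = ℚ.positive 0<K
      K-nonZero : ℚ.NonZero K
      K-nonZero = ℚ.pos⇒nonZero K

    0<ε/K : 0ℚ ℚ.< ℚ.1/ K ℚ.* ε
    0<ε/K = ℚ.positive⁻¹ _ {{ℚ.pos*pos⇒pos (ℚ.1/ K) {{ℚ.1/pos⇒pos K}} ε {{ℚ.positive 0<ε}}}}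

    K*ε/K≡ε : K ℚ.* (ℚ.1/ K ℚ.* ε) ≡ ε
    K*ε/K≡ε = trans (sym (ℚ.*-assoc K (ℚ.1/ K) ε))
      (trans (cong (ℚ._* ε) (ℚ.*-inverseʳ K)) (ℚ.*-identityˡ ε))

  cauchy⇒bounded : ∀ x → IsCauchy x → Bounded x
  cauchy⇒bounded x cx with cx 1ℚ (ℚ.positive⁻¹ 1ℚ)
  ... | N , close =
    -- From N on, the terms lie within 1 of `x N`.
    1ℚ ℚ.+ ℚ.∣ x N ∣ , ℚ.+-mono-<-≤ (ℚ.positive⁻¹ 1ℚ) (ℚ.0≤∣p∣ (x N)) , N , λ n N≤n →
    ℚ.≤-trans
      (subst (λ q → ℚ.∣ q ∣ ℚ.≤ ℚ.∣ x n ℚ.- x N ∣ ℚ.+ ℚ.∣ x N ∣)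
        (solve 2 (λ p q → p :+ :- q :+ q := p) refl (x n) (x N))
        (ℚ.∣p+q∣≤∣p∣+∣q∣ (x n ℚ.- x N) (x N)))
      (ℚ.+-monoˡ-≤ ℚ.∣ x N ∣ (ℚ.<⇒≤ (close n N N≤n ℕ.≤-refl)))

  -- The operations act termwise on sequences, so an identity of rationals at every index proves one
  -- of reals; the algebraic laws of ℂ below reduce to this.
  pointwise : {p q : ℕ → ℚ} → (∀ n → p n ≡ q n) → Null (λ n → p n ℚ.- q n)
  pointwise {p} {q} eq =
    null-resp (λ n → sym (trans (cong (ℚ._- q n) (eq n)) (ℚ.+-inverseʳ (q n)))) null-0

  ≈ᴿ-refl : ∀ {x} → x ≈ᴿ x
  ≈ᴿ-refl {x} = pointwise {seq x} (λ _ → refl)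

  ≈ᴿ-sym : ∀ {x y} → x ≈ᴿ y → y ≈ᴿ x
  ≈ᴿ-sym {x} {y} x≈y = null-resp
    (λ n → solve 2 (λ p q → :- (p :+ :- q) := q :+ :- p) refl (seq x n) (seq y n))
    (null-neg x≈y)

  ≈ᴿ-trans : ∀ {x y z} → x ≈ᴿ y → y ≈ᴿ z → x ≈ᴿ z
  ≈ᴿ-trans {x} {y} {z} x≈y y≈z = null-resp
    (λ n → solve 3 (λ p q r → p :+ :- q :+ (q :+ :- r) := p :+ :- r) refl (seq x n) (seq y n) (seq z n))
    (null-+ x≈y y≈z)

  +ᴿ-cong : ∀ {x y u v} → x ≈ᴿ y → u ≈ᴿ v → x +ᴿ u ≈ᴿ y +ᴿ v
  +ᴿ-cong {x} {y} {u} {v} x≈y u≈v = null-resp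
    (λ n → solve 4 (λ p q r s → p :+ :- q :+ (r :+ :- s) := p :+ r :+ :- (q :+ s)) refl
      (seq x n) (seq y n) (seq u n) (seq v n))
    (null-+ x≈y u≈v)

  -ᴿ-cong : ∀ {x y} → x ≈ᴿ y → -ᴿ x ≈ᴿ -ᴿ y
  -ᴿ-cong {x} {y} x≈y = null-resp
    (λ n → solve 2 (λ p q → :- (p :+ :- q) := :- p :+ :- (:- q)) refl (seq x n) (seq y n))
    (null-neg x≈y)

  -- Splitting xu - yv as x(u - v) + v(x - y) leaves two products of a bounded and a null sequence.
  *ᴿ-cong : ∀ {x y u v} → x ≈ᴿ y → u ≈ᴿ v → x *ᴿ u ≈ᴿ y *ᴿ v
  *ᴿ-cong {x} {y} {u} {v} x≈y u≈v = null-resp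
    (λ n → solve 4 (λ p q r s → p :* (r :+ :- s) :+ s :* (p :+ :- q) := p :* r :+ :- (q :* s)) refl
      (seq x n) (seq y n) (seq u n) (seq v n))
    (null-+ (null-* {seq x} (cauchy⇒bounded (seq x) (cauchy x)) u≈v)
            (null-* {seq v} (cauchy⇒bounded (seq v) (cauchy v)) x≈y))

  ℂ-commutativeRing : CommutativeRing 0ℓ 0ℓ
  ℂ-commutativeRing = record
    { Carrier = ℂ ; _≈_ = ℂ._≈_ ; _+_ = ℂ._+_ ; _*_ = ℂ._*_ ; -_ = ℂ.-_ ; 0# = 0ᶜ ; 1# = 1ᶜ
    ; isCommutativeRing = record
      { isRing = record
        { +-isAbelianGroup = record
          { isGroup = record
            { isMonoid = record
              { isSemigroup = record
                { isMagma = record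
                  { isEquivalence = record
                    { refl  = λ {z} → ≈ᴿ-refl {re z} , ≈ᴿ-refl {im z}
                    ; sym   = λ {w} {z} (p , q) → ≈ᴿ-sym {re w} {re z} p , ≈ᴿ-sym {im w} {im z} q
                    ; trans = λ {v} {w} {z} (p , q) (p′ , q′) →
                        ≈ᴿ-trans {re v} {re w} {re z} p p′ , ≈ᴿ-trans {im v} {im w} {im z} q q′
                    }
                  ; ∙-cong = λ {v} {w} {y} {z} (p , q) (p′ , q′) →
                      +ᴿ-cong {re v} {re w} {re y} {re z} p p′ , +ᴿ-cong {im v} {im w} {im y} {im z} q q′
                  }
                ; assoc = λ v w z →
                    pointwise (λ n → ℚ.+-assoc (seq (re v) n) (seq (re w) n) (seq (re z) n)) ,
                    pointwise (λ n → ℚ.+-assoc (seq (im v) n) (seq (im w) n) (seq (im z) n))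
                }
              ; identity = (λ z →
                pointwise (λ n → ℚ.+-identityˡ (seq (re z) n)) ,
                pointwise (λ n → ℚ.+-identityˡ (seq (im z) n)))
              , (λ z →
                pointwise (λ n → ℚ.+-identityʳ (seq (re z) n)) ,
                pointwise (λ n → ℚ.+-identityʳ (seq (im z) n)))
              }
            ; inverse = (λ z →
                pointwise (λ n → ℚ.+-inverseˡ (seq (re z) n)) ,
                pointwise (λ n → ℚ.+-inverseˡ (seq (im z) n)))
              , (λ z →
                pointwise (λ n → ℚ.+-inverseʳ (seq (re z) n)) ,
                pointwise (λ n → ℚ.+-inverseʳ (seq (im z) n)))
            ; ⁻¹-cong = λ {w} {z} (p , q) → -ᴿ-cong {re w} {re z} p , -ᴿ-cong {im w} {im z} q
            }
          ; comm = λ w z →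
              pointwise (λ n → ℚ.+-comm (seq (re w) n) (seq (re z) n)) ,
              pointwise (λ n → ℚ.+-comm (seq (im w) n) (seq (im z) n))
          }
        ; *-cong = λ {v} {w} {y} {z} → *-cong v w y z
        ; *-assoc = λ v w z →
            pointwise (λ n → solve 6 (λ a b c d e f →
                (a :* c :+ :- (b :* d)) :* e :+ :- ((a :* d :+ b :* c) :* f)
              := a :* (c :* e :+ :- (d :* f)) :+ :- (b :* (c :* f :+ d :* e))) refl
              (seq (re v) n) (seq (im v) n) (seq (re w) n) (seq (im w) n) (seq (re z) n) (seq (im z) n)) ,
            pointwise (λ n → solve 6 (λ a b c d e f →
                (a :* c :+ :- (b :* d)) :* f :+ (a :* d :+ b :* c) :* e
              := a :* (c :* f :+ d :* e) :+ b :* (c :* e :+ :- (d :* f))) refl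
              (seq (re v) n) (seq (im v) n) (seq (re w) n) (seq (im w) n) (seq (re z) n) (seq (im z) n))
        ; *-identity = (λ z →
            pointwise (λ n → solve 2 (λ a b → con 1ℚ :* a :+ :- (con 0ℚ :* b) := a) refl
              (seq (re z) n) (seq (im z) n)) ,
            pointwise (λ n → solve 2 (λ a b → con 1ℚ :* b :+ con 0ℚ :* a := b) refl
              (seq (re z) n) (seq (im z) n)))
          , (λ z →
            pointwise (λ n → solve 2 (λ a b → a :* con 1ℚ :+ :- (b :* con 0ℚ) := a) refl
              (seq (re z) n) (seq (im z) n)) ,
            pointwise (λ n → solve 2 (λ a b → a :* con 0ℚ :+ b :* con 1ℚ := b) refl
              (seq (re z) n) (seq (im z) n)))
        ; distrib = (λ v w z →
            pointwise (λ n → solve 6 (λ a b c d e f →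
                a :* (c :+ e) :+ :- (b :* (d :+ f))
              := a :* c :+ :- (b :* d) :+ (a :* e :+ :- (b :* f))) refl
              (seq (re v) n) (seq (im v) n) (seq (re w) n) (seq (im w) n) (seq (re z) n) (seq (im z) n)) ,
            pointwise (λ n → solve 6 (λ a b c d e f →
                a :* (d :+ f) :+ b :* (c :+ e)
              := a :* d :+ b :* c :+ (a :* f :+ b :* e)) refl
              (seq (re v) n) (seq (im v) n) (seq (re w) n) (seq (im w) n) (seq (re z) n) (seq (im z) n)))
          , (λ v w z →
            pointwise (λ n → solve 6 (λ a b c d e f →
                (c :+ e) :* a :+ :- ((d :+ f) :* b)
              := c :* a :+ :- (d :* b) :+ (e :* a :+ :- (f :* b))) refl
              (seq (re v) n) (seq (im v) n) (seq (re w) n) (seq (im w) n) (seq (re z) n) (seq (im z) n)) ,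
            pointwise (λ n → solve 6 (λ a b c d e f →
                (c :+ e) :* b :+ (d :+ f) :* a
              := c :* b :+ d :* a :+ (e :* b :+ f :* a)) refl
              (seq (re v) n) (seq (im v) n) (seq (re w) n) (seq (im w) n) (seq (re z) n) (seq (im z) n)))
        }
      ; *-comm = λ w z →
          pointwise (λ n → solve 4 (λ a b c d → a :* c :+ :- (b :* d) := c :* a :+ :- (d :* b)) refl
            (seq (re w) n) (seq (im w) n) (seq (re z) n) (seq (im z) n)) ,
          pointwise (λ n → solve 4 (λ a b c d → a :* d :+ b :* c := c :* b :+ d :* a) refl
            (seq (re w) n) (seq (im w) n) (seq (re z) n) (seq (im z) n))
      }
    }
    where
    *-cong : ∀ v w y z → v ℂ.≈ w → y ℂ.≈ z → v ℂ.* y ℂ.≈ w ℂ.* z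
    *-cong v w y z (p , q) (p′ , q′) =
        +ᴿ-cong {re v *ᴿ re y} {re w *ᴿ re z} { -ᴿ (im v *ᴿ im y)} { -ᴿ (im w *ᴿ im z)}
          (*ᴿ-cong {re v} {re w} {re y} {re z} p p′)
          (-ᴿ-cong {im v *ᴿ im y} {im w *ᴿ im z} (*ᴿ-cong {im v} {im w} {im y} {im z} q q′))
      , +ᴿ-cong {re v *ᴿ im y} {re w *ᴿ im z} {im v *ᴿ re y} {im w *ᴿ re z}
          (*ᴿ-cong {re v} {re w} {im y} {im z} p q′)
          (*ᴿ-cong {im v} {im w} {re y} {re z} q p′)

  -- Conjugation, and the embedding of the reals.

  conj-cong : ∀ {w z} → w ℂ.≈ z → conj w ℂ.≈ conj z
  conj-cong {w} {z} (p , q) = p , -ᴿ-cong {im w} {im z} q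

  conj-+ : ∀ w z → conj (w ℂ.+ z) ℂ.≈ conj w ℂ.+ conj z
  conj-+ w z = pointwise {seq (re w +ᴿ re z)} (λ _ → refl) ,
               pointwise (λ n → ℚ.neg-distrib-+ (seq (im w) n) (seq (im z) n))

  conj-* : ∀ w z → conj (w ℂ.* z) ℂ.≈ conj w ℂ.* conj z
  conj-* w z =
    pointwise (λ n → solve 4 (λ a b c d → a :* c :+ :- (b :* d) := a :* c :+ :- (:- b :* :- d)) refl
      (seq (re w) n) (seq (im w) n) (seq (re z) n) (seq (im z) n)) ,
    pointwise (λ n → solve 4 (λ a b c d → :- (a :* d :+ b :* c) := a :* :- d :+ :- b :* c) refl
      (seq (re w) n) (seq (im w) n) (seq (re z) n) (seq (im z) n))

  conj-involutive : ∀ z → conj (conj z) ℂ.≈ z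
  conj-involutive z = pointwise {seq (re z)} (λ _ → refl) ,
                      pointwise (λ n → solve 1 (λ b → :- (:- b) := b) refl (seq (im z) n))

  z*conj-z : ∀ z → z ℂ.* conj z ℂ.≈ ofReal ∣ z ∣²
  z*conj-z z =
    pointwise (λ n → solve 2 (λ a b → a :* a :+ :- (b :* :- b) := a :* a :+ b :* b) refl
      (seq (re z) n) (seq (im z) n)) ,
    pointwise (λ n → solve 2 (λ a b → a :* :- b :+ b :* a := con 0ℚ) refl (seq (re z) n) (seq (im z) n))

  ofReal-cong : ∀ {x y} → x ≈ᴿ y → ofReal x ℂ.≈ ofReal y
  ofReal-cong x≈y = x≈y , pointwise {λ _ → 0ℚ} (λ _ → refl)

  ofReal-* : ∀ x y → ofReal (x *ᴿ y) ℂ.≈ ofReal x ℂ.* ofReal y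
  ofReal-* x y =
    pointwise (λ n → solve 2 (λ a b → a :* b := a :* b :+ :- (con 0ℚ :* con 0ℚ)) refl (seq x n) (seq y n)) ,
    pointwise (λ n → solve 2 (λ a b → con 0ℚ := a :* con 0ℚ :+ con 0ℚ :* b) refl (seq x n) (seq y n))

  ofReal-1- : ∀ x → ofReal (1ᴿ +ᴿ -ᴿ x) ℂ.≈ 1ᶜ ℂ.- ofReal x
  ofReal-1- x = pointwise {seq (1ᴿ +ᴿ -ᴿ x)} (λ _ → refl) , pointwise {λ _ → 0ℚ} (λ _ → refl)

  -- Past the index from which `seq x n` is at least δ, the maximum in `Inverse.term` is `seq x n`
  -- itself, so the product is exactly 1 there.
  *-inverseᴿ : ∀ x (x>0 : 0ᴿ <ᴿ x) → x *ᴿ inverseᴿ x x>0 ≈ᴿ 1ᴿ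
  *-inverseᴿ x x>0 ε 0<ε = eventually-map
    (λ n δ≤x → subst (λ q → ℚ.∣ q ∣ ℚ.< ε) (sym (vanishes n δ≤x)) 0<ε)
    (proj₂ (proj₂ x>0))
    where
    open Inverse x x>0

    vanishes : ∀ n → 0ℚ ℚ.+ δ ℚ.≤ seq x n → seq x n ℚ.* inverseTerm n ℚ.- 1ℚ ≡ 0ℚ
    vanishes n δ≤x = trans
      (cong (λ q → q ℚ.* inverseTerm n ℚ.- 1ℚ)
        (sym (ℚ.p≥q⇒p⊔q≡p (subst (ℚ._≤ seq x n) (ℚ.+-identityˡ δ) δ≤x))))
      (trans (cong (ℚ._- 1ℚ) (ℚ.*-inverseʳ (term n))) (ℚ.+-inverseʳ 1ℚ))

  -- Positivity of reals and division of complex numbers.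

  p≤∣p∣ : ∀ p → p ℚ.≤ ℚ.∣ p ∣
  p≤∣p∣ p with ℚ.≤-total 0ℚ p
  ... | inj₁ 0≤p = ℚ.≤-reflexive (sym (ℚ.0≤p⇒∣p∣≡p 0≤p))
  ... | inj₂ p≤0 = ℚ.≤-trans p≤0 (ℚ.0≤∣p∣ p)

  ∣p-q∣<e⇒p<q+e : ∀ p q {e} → ℚ.∣ p ℚ.- q ∣ ℚ.< e → p ℚ.< q ℚ.+ e
  ∣p-q∣<e⇒p<q+e p q {e} close = subst (ℚ._< q ℚ.+ e)
    (solve 2 (λ p q → q :+ (p :+ :- q) := p) refl p q)
    (ℚ.+-monoʳ-< q (ℚ.≤-<-trans (p≤∣p∣ (p ℚ.- q)) close))

  -- Half of the lower bound ε survives; the other half pays for the distance between the two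
  -- sequences.
  positive-resp : ∀ {x y} → x ≈ᴿ y → 0ᴿ <ᴿ x → 0ᴿ <ᴿ y
  positive-resp {x} {y} x≈y (ε , 0<ε , x≥ε) = ½ ℚ.* ε , half-positive 0<ε , eventually-∩ lower
    x≥ε (x≈y (½ ℚ.* ε) (half-positive 0<ε))
    where
    lower : ∀ n → 0ℚ ℚ.+ ε ℚ.≤ seq x n → ℚ.∣ seq x n ℚ.- seq y n ∣ ℚ.< ½ ℚ.* ε →
            0ℚ ℚ.+ ½ ℚ.* ε ℚ.≤ seq y n
    lower n ε≤x close = subst₂ ℚ._≤_
      (trans (cong (λ e → 0ℚ ℚ.+ e ℚ.- ½ ℚ.* ε) (sym (half+half ε)))
        (solve 1 (λ h → con 0ℚ :+ (h :+ h) :+ :- h := con 0ℚ :+ h) refl (½ ℚ.* ε)))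
      (solve 2 (λ y h → y :+ h :+ :- h := y) refl (seq y n) (½ ℚ.* ε))
      (ℚ.+-monoˡ-≤ (ℚ.- (½ ℚ.* ε))
        (ℚ.≤-trans ε≤x (ℚ.<⇒≤ (∣p-q∣<e⇒p<q+e (seq x n) (seq y n) close))))

  1-positive : 0ᴿ <ᴿ 1ᴿ
  1-positive = 1ℚ , ℚ.positive⁻¹ 1ℚ , 0 , λ _ _ → ℚ.≤-refl

  *-positive : ∀ {x y} → 0ᴿ <ᴿ x → 0ᴿ <ᴿ y → 0ᴿ <ᴿ x *ᴿ y
  *-positive {x} {y} (ε , 0<ε , x≥ε) (δ , 0<δ , y≥δ) =
    ε ℚ.* δ , ℚ.positive⁻¹ _ {{ℚ.pos*pos⇒pos ε δ}} , eventually-∩ lower x≥ε y≥δ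
    where
    instance
      ε-pos : ℚ.Positive ε
      ε-pos = ℚ.positive 0<ε
      δ-pos : ℚ.Positive δ
      δ-pos = ℚ.positive 0<δ

    lower : ∀ n → 0ℚ ℚ.+ ε ℚ.≤ seq x n → 0ℚ ℚ.+ δ ℚ.≤ seq y n → 0ℚ ℚ.+ ε ℚ.* δ ℚ.≤ seq x n ℚ.* seq y n
    lower n ε≤x δ≤y = subst (ℚ._≤ seq x n ℚ.* seq y n) (sym (ℚ.+-identityˡ (ε ℚ.* δ)))
      (ℚ.≤-trans (ℚ.*-monoˡ-≤-nonNeg ε {{ℚ.pos⇒nonNeg ε}} (subst (ℚ._≤ seq y n) (ℚ.+-identityˡ δ) δ≤y))
        (ℚ.*-monoʳ-≤-nonNeg (seq y n) {{ℚ.nonNegative 0≤y}} (subst (ℚ._≤ seq x n) (ℚ.+-identityˡ ε) ε≤x)))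
      where
      0≤y : 0ℚ ℚ.≤ seq y n
      0≤y = ℚ.≤-trans (ℚ.<⇒≤ 0<δ) (subst (ℚ._≤ seq y n) (ℚ.+-identityˡ δ) δ≤y)

  -- The hypothesis is the negation of `r <ᴿ 0ᴿ` and bounds no term directly. Choose N from which
  -- terms differ by less than 1/4 and compare `seq r N` with -1/2: if it is at most -1/2, all later
  -- terms stay below -1/4, a contradiction; otherwise they all exceed -3/4.
  1+nonNegative-positive : ∀ r → 0ᴿ ≤ᴿ r → 0ᴿ <ᴿ 1ᴿ +ᴿ r
  1+nonNegative-positive r 0≤r with cauchy r ¼ (ℚ.positive⁻¹ ¼)
    where ¼ = ½ ℚ.* ½
  ... | N , close with seq r N ℚ.≤? ℚ.- ½
  ...   | yes r≤-½ = ⊥-elim (0≤r (½ ℚ.* ½ , ℚ.positive⁻¹ (½ ℚ.* ½) , N , λ n N≤n →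
    ℚ.≤-trans
      (ℚ.+-monoˡ-≤ (½ ℚ.* ½) (ℚ.<⇒≤ (∣p-q∣<e⇒p<q+e (seq r n) (seq r N) (close n N N≤n ℕ.≤-refl))))
      (ℚ.+-monoˡ-≤ (½ ℚ.* ½) (ℚ.+-monoˡ-≤ (½ ℚ.* ½) r≤-½))))
  ...   | no r≰-½ = ½ ℚ.* ½ , ℚ.positive⁻¹ (½ ℚ.* ½) , N , λ n N≤n →
    subst (0ℚ ℚ.+ ½ ℚ.* ½ ℚ.≤_)
      (solve 1 (λ r → con ¾ :+ (r :+ con (½ ℚ.* ½)) := con 1ℚ :+ r) refl (seq r n))
      (ℚ.+-monoʳ-≤ ¾
        (ℚ.≤-trans (ℚ.<⇒≤ (ℚ.≰⇒> r≰-½))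
          (ℚ.<⇒≤ (∣p-q∣<e⇒p<q+e (seq r N) (seq r n) (close N n ℕ.≤-refl N≤n)))))
    where ¾ = ½ ℚ.+ ½ ℚ.* ½

  <⇒positive-difference : ∀ {x y} → x <ᴿ y → 0ᴿ <ᴿ y +ᴿ -ᴿ x
  <⇒positive-difference {x} {y} (ε , 0<ε , x+ε≤y) = ε , 0<ε , eventually-map
    (λ n le → subst (ℚ._≤ seq y n ℚ.- seq x n)
      (solve 2 (λ x e → x :+ e :+ :- x := con 0ℚ :+ e) refl (seq x n) ε)
      (ℚ.+-monoˡ-≤ (ℚ.- seq x n) le))
    x+ε≤y

  -- A modulus r factors 1 - |z|² as (1 - r)(1 + r), and both factors are positive.
  1-∣z∣²-positive : ∀ {z} → ∣ z ∣< 1ᴿ → 0ᴿ <ᴿ 1ᴿ +ᴿ -ᴿ ∣ z ∣²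
  1-∣z∣²-positive {z} (r , (0≤r , r²≈∣z∣²) , r<1) = positive-resp
    {(1ᴿ +ᴿ -ᴿ r) *ᴿ (1ᴿ +ᴿ r)} {1ᴿ +ᴿ -ᴿ ∣ z ∣²}
    (≈ᴿ-trans {(1ᴿ +ᴿ -ᴿ r) *ᴿ (1ᴿ +ᴿ r)} {1ᴿ +ᴿ -ᴿ (r *ᴿ r)} {1ᴿ +ᴿ -ᴿ ∣ z ∣²}
      (pointwise (λ n → solve 1 (λ r → (con 1ℚ :+ :- r) :* (con 1ℚ :+ r) := con 1ℚ :+ :- (r :* r)) refl
        (seq r n)))
      (+ᴿ-cong {1ᴿ} {1ᴿ} { -ᴿ (r *ᴿ r)} { -ᴿ ∣ z ∣²} (≈ᴿ-refl {1ᴿ})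
        (-ᴿ-cong {r *ᴿ r} {∣ z ∣²} r²≈∣z∣²)))
    (*-positive {1ᴿ +ᴿ -ᴿ r} {1ᴿ +ᴿ r}
      (<⇒positive-difference {r} {1ᴿ} r<1) (1+nonNegative-positive r 0≤r))

  -- Apartness from zero is stated for the squared modulus, which here is t².
  ≈ofReal⇒≉0 : ∀ {z t} → z ℂ.≈ ofReal t → 0ᴿ <ᴿ t → z ≉0
  ≈ofReal⇒≉0 {z} {t} (p , q) t>0 = positive-resp {t *ᴿ t} {∣ z ∣²}
    (≈ᴿ-trans {t *ᴿ t} {t *ᴿ t +ᴿ 0ᴿ *ᴿ 0ᴿ} {∣ z ∣²}
      (pointwise (λ n → solve 1 (λ t → t :* t := t :* t :+ con 0ℚ :* con 0ℚ) refl (seq t n)))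
      (≈ᴿ-sym {∣ z ∣²} {t *ᴿ t +ᴿ 0ᴿ *ᴿ 0ᴿ}
        (+ᴿ-cong {re z *ᴿ re z} {t *ᴿ t} {im z *ᴿ im z} {0ᴿ *ᴿ 0ᴿ}
          (*ᴿ-cong {re z} {t} {re z} {t} p p) (*ᴿ-cong {im z} {0ᴿ} {im z} {0ᴿ} q q))))
    (*-positive {t} {t} t>0 t>0)

  -- The quotient is w z̄ |z|⁻² by definition, and z z̄ = |z|². This reduces the theorem to an
  -- identity without division.
  /-unique : ∀ w z c {z≉0 : z ≉0} → w ℂ.≈ c ℂ.* z → (w ℂ./ z) {z≉0} ℂ.≈ c
  /-unique w z c {z≉0} w≈cz = begin
    w * conj z * i
      ≈⟨ *-congʳ {i} {w * conj z} {c * z * conj z} (*-congʳ {conj z} {w} {c * z} w≈cz) ⟩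
    c * z * conj z * i
      ≈⟨ *-congʳ {i} {c * z * conj z} {c * (z * conj z)} (*-assoc c z (conj z)) ⟩
    c * (z * conj z) * i       ≈⟨ *-assoc c (z * conj z) i ⟩
    c * (z * conj z * i)
      ≈⟨ *-congˡ {c} {z * conj z * i} {ofReal ∣ z ∣² * i}
           (*-congʳ {i} {z * conj z} {ofReal ∣ z ∣²} (z*conj-z z)) ⟩
    c * (ofReal ∣ z ∣² * i)
      ≈⟨ *-congˡ {c} {ofReal (∣ z ∣² *ᴿ inverseᴿ ∣ z ∣² z≉0)} {ofReal ∣ z ∣² * i}
           (ofReal-* ∣ z ∣² (inverseᴿ ∣ z ∣² z≉0)) ⟨
    c * ofReal (∣ z ∣² *ᴿ inverseᴿ ∣ z ∣² z≉0)
      ≈⟨ *-congˡ {c} {ofReal (∣ z ∣² *ᴿ inverseᴿ ∣ z ∣² z≉0)} {1ᶜ}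
           (ofReal-cong {∣ z ∣² *ᴿ inverseᴿ ∣ z ∣² z≉0} {1ᴿ} (*-inverseᴿ ∣ z ∣² z≉0)) ⟩
    c * 1ᶜ                     ≈⟨ *-identityʳ c ⟩
    c                          ∎
    where
    open CommutativeRing ℂ-commutativeRing
    open SetoidReasoning setoid
    i : ℂ
    i = ofReal (inverseᴿ ∣ z ∣² z≉0)

-- Finite sums and products in a commutative ring.

module Sums (R : CommutativeRing 0ℓ 0ℓ) where
  open CommutativeRing R
  open SetoidReasoning setoid

  sum product : List Carrier → Carrier
  sum = foldr _+_ 0#
  product = foldr _*_ 1#

  sum-++ : ∀ xs ys → sum (xs ++ ys) ≈ sum xs + sum ys
  sum-++ []       ys = sym (+-identityˡ _)
  sum-++ (x ∷ xs) ys = trans (+-congˡ (sum-++ xs ys)) (sym (+-assoc _ _ _))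

  sum-cong : ∀ {A : Set} {f g : A → Carrier} → (∀ x → f x ≈ g x) → ∀ xs → sum (map f xs) ≈ sum (map g xs)
  sum-cong eq []       = refl
  sum-cong eq (x ∷ xs) = +-cong (eq x) (sum-cong eq xs)

  sum-concatMap : ∀ {A B : Set} (f : B → Carrier) (g : A → List B) xs →
                  sum (map f (concatMap g xs)) ≈ sum (map (λ x → sum (map f (g x))) xs)
  sum-concatMap f g []       = refl
  sum-concatMap f g (x ∷ xs) = begin
    sum (map f (g x ++ concatMap g xs))              ≡⟨ ≡.cong sum (List.map-++ f (g x) _) ⟩
    sum (map f (g x) ++ map f (concatMap g xs))      ≈⟨ sum-++ (map f (g x)) _ ⟩
    sum (map f (g x)) + sum (map f (concatMap g xs)) ≈⟨ +-congˡ (sum-concatMap f g xs) ⟩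
    sum (map (λ x → sum (map f (g x))) (x ∷ xs))     ∎

  sum-map-* : ∀ {A : Set} c (f : A → Carrier) xs → sum (map (λ x → c * f x) xs) ≈ c * sum (map f xs)
  sum-map-* c f []       = sym (zeroʳ c)
  sum-map-* c f (x ∷ xs) = trans (+-congˡ (sum-map-* c f xs)) (sym (distribˡ _ _ _))

  ∑< ∏< : ℕ → (ℕ → Carrier) → Carrier
  ∑< n f = sum (map f (upTo n))
  ∏< n f = product (map f (upTo n))

  -- `foldr` over `upTo` exposes the first index, whereas the recursion in the height adds its new
  -- term at the top; hence the last index is split off.
  ∑<-suc : ∀ n f → ∑< (suc n) f ≈ ∑< n f + f n
  ∑<-suc n f = begin
    sum (map f (upTo (suc n)))        ≡⟨ ≡.cong (sum ∘ map f) (List.upTo-∷ʳ n) ⟨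
    sum (map f (upTo n ++ [ n ]))     ≡⟨ ≡.cong sum (List.map-++ f (upTo n) [ n ]) ⟩
    sum (map f (upTo n) ++ [ f n ])   ≈⟨ sum-++ (map f (upTo n)) [ f n ] ⟩
    ∑< n f + (f n + 0#)               ≈⟨ +-congˡ (+-identityʳ _) ⟩
    ∑< n f + f n                      ∎

  product-∷ʳ : ∀ xs y → product (xs ++ [ y ]) ≈ product xs * y
  product-∷ʳ []       y = *-comm y 1#
  product-∷ʳ (x ∷ xs) y = trans (*-congˡ (product-∷ʳ xs y)) (sym (*-assoc _ _ _))

  ∏<-suc : ∀ n f → ∏< (suc n) f ≈ ∏< n f * f n
  ∏<-suc n f = begin
    product (map f (upTo (suc n)))        ≡⟨ ≡.cong (product ∘ map f) (List.upTo-∷ʳ n) ⟨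
    product (map f (upTo n ++ [ n ]))     ≡⟨ ≡.cong product (List.map-++ f (upTo n) [ n ]) ⟩
    product (map f (upTo n) ++ [ f n ])   ≈⟨ product-∷ʳ (map f (upTo n)) (f n) ⟩
    ∏< n f * f n                          ∎

  ∑<-cong : ∀ n {f g} → (∀ i → i ℕ.< n → f i ≈ g i) → ∑< n f ≈ ∑< n g
  ∑<-cong zero    eq = refl
  ∑<-cong (suc n) {f} {g} eq = begin
    ∑< (suc n) f   ≈⟨ ∑<-suc n f ⟩
    ∑< n f + f n   ≈⟨ +-cong (∑<-cong n (λ i i<n → eq i (ℕ.m<n⇒m<1+n i<n))) (eq n (ℕ.n<1+n n)) ⟩
    ∑< n g + g n   ≈⟨ ∑<-suc n g ⟨
    ∑< (suc n) g   ∎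

  *-∑< : ∀ n c f → c * ∑< n f ≈ ∑< n (λ i → c * f i)
  *-∑< n c f = sym (sum-map-* c f (upTo n))

-- Weighted Łukasiewicz paths from a pair of recursions.

-- ᾱ₋ n stands for the conjugate of αₙ₋₁.
module Łukasiewicz (R : CommutativeRing 0ℓ 0ℓ)
  (α ᾱ ᾱ₋ ρ : ℕ → CommutativeRing.Carrier R) where

  open CommutativeRing R
  open SetoidReasoning setoid
  open SemiringSolver commutativeSemiring using (solve; _:=_; _:*_)
  open RingProperties ring
  open Sums R

  descent : ℕ → ℕ → Carrier
  descent b b′ = - α b * ᾱ₋ b′ * ∏< (b ℕ.∸ b′) (λ i → ρ (b′ ℕ.+ i))

  weight : ℕ → ℕ → Carrier
  weight b b′ = if does (b′ ℕ.≟ suc b) then 1# else descent b b′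

  -- Weights depend on heights alone, so the abscissa is dropped. The recursion removes the first
  -- step, whose end b ranges from 0 to r + 1.
  paths : ℕ → ℕ → ℕ → Carrier
  paths zero    r s = if does (r ℕ.≟ s) then 1# else 0#
  paths (suc n) r s = ∑< (2 ℕ.+ r) (λ b → weight r b * paths n b s)

  weight-up : ∀ b → weight b (suc b) ≡ 1#
  weight-up b = ≡.cong (if_then 1# else descent b (suc b)) (dec-true (suc b ℕ.≟ suc b) ≡.refl)

  weight-down : ∀ {b b′} → b′ ℕ.≤ b → weight b b′ ≡ descent b b′
  weight-down {b} {b′} b′≤b = ≡.cong (if_then 1# else descent b b′)
    (dec-false (b′ ℕ.≟ suc b) λ { ≡.refl → ℕ.1+n≰n b′≤b })

  module _ (ᾱ₋-zero : ᾱ₋ 0 ≈ - 1#) (ᾱ₋-suc : ∀ n → ᾱ₋ (suc n) ≈ ᾱ n)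
    (A B : ℕ → ℕ → Carrier)
    (A-suc  : ∀ n r → A (suc n) r ≈ A n (suc r) + α r * B n r)
    (B-zero : ∀ n → B n 0 ≈ A n 0)
    (B-suc  : ∀ n r → B n (suc r) ≈ ρ r * B n r + - ᾱ r * A n (suc r)) where

    -- The weight of the descent from r to b without its factor `α r`, with the minus sign moved to
    -- `ᾱ₋ b`, times `A n b`.
    term : ℕ → ℕ → ℕ → Carrier
    term n r b = - ᾱ₋ b * ∏< (r ℕ.∸ b) (λ i → ρ (b ℕ.+ i)) * A n b

    term-last : ∀ n r → term n r r ≈ - ᾱ₋ r * A n r
    term-last n r rewrite ℕ.n∸n≡0 r = *-congʳ (*-identityʳ _)

    -- Raising the starting height from r to r + 1 appends one factor to the product, and its index
    -- b + (r - b) is r.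
    term-suc : ∀ n {r b} → b ℕ.≤ r → term n (suc r) b ≈ ρ r * term n r b
    term-suc n {r} {b} b≤r rewrite ℕ.+-∸-assoc 1 b≤r = begin
      - ᾱ₋ b * ∏< (suc (r ℕ.∸ b)) f * A n b
        ≈⟨ *-congʳ (*-congˡ (∏<-suc (r ℕ.∸ b) f)) ⟩
      - ᾱ₋ b * (∏< (r ℕ.∸ b) f * ρ (b ℕ.+ (r ℕ.∸ b))) * A n b
        ≡⟨ ≡.cong (λ j → - ᾱ₋ b * (∏< (r ℕ.∸ b) f * ρ j) * A n b) (ℕ.m+[n∸m]≡n b≤r) ⟩
      - ᾱ₋ b * (∏< (r ℕ.∸ b) f * ρ r) * A n b
        ≈⟨ solve 4 (λ x p q a → x :* (p :* q) :* a := q :* (x :* p :* a)) refl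
             (- ᾱ₋ b) (∏< (r ℕ.∸ b) f) (ρ r) (A n b) ⟩
      ρ r * term n r b ∎
      where
      f : ℕ → Carrier
      f i = ρ (b ℕ.+ i)

    -- Induction on r: `B-suc` multiplies every earlier term by `ρ r` and adds the term of index r +
    -- 1.
    B-expansion : ∀ n r → B n r ≈ ∑< (suc r) (term n r)
    B-expansion n zero = begin
      B n 0                       ≈⟨ B-zero n ⟩
      A n 0                       ≈⟨ *-identityˡ _ ⟨
      -- The convention α₋₁ = -1 makes the coefficient of the single term equal to 1.
      1# * A n 0                  ≈⟨ *-congʳ (-‿involutive 1#) ⟨
      - (- 1#) * A n 0            ≈⟨ *-congʳ (-‿cong ᾱ₋-zero) ⟨
      - ᾱ₋ 0 * A n 0              ≈⟨ term-last n 0 ⟨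
      term n 0 0                  ≈⟨ +-identityʳ _ ⟨
      ∑< 1 (term n 0)             ∎
    B-expansion n (suc r) = begin
      B n (suc r)                                        ≈⟨ B-suc n r ⟩
      ρ r * B n r + - ᾱ r * A n (suc r)
        ≈⟨ +-cong (*-congˡ (B-expansion n r)) (*-congʳ (-‿cong (sym (ᾱ₋-suc r)))) ⟩
      ρ r * ∑< (suc r) (term n r) + - ᾱ₋ (suc r) * A n (suc r)
        ≈⟨ +-cong (*-∑< (suc r) (ρ r) (term n r)) (sym (term-last n (suc r))) ⟩
      ∑< (suc r) (λ b → ρ r * term n r b) + term n (suc r) (suc r)
        ≈⟨ +-congʳ (∑<-cong (suc r) (λ b b≤r → term-suc n (ℕ.≤-pred b≤r))) ⟨
      ∑< (suc r) (term n (suc r)) + term n (suc r) (suc r)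
        ≈⟨ ∑<-suc (suc r) (term n (suc r)) ⟨
      ∑< (2 ℕ.+ r) (term n (suc r)) ∎

    -- `A n (suc r)` accounts for the up-step, and `α r * B n r` spreads over the end heights 0,
    -- ..., r of the other steps.
    A-expansion : ∀ n r → A (suc n) r ≈ ∑< (2 ℕ.+ r) (λ b → weight r b * A n b)
    A-expansion n r = begin
      A (suc n) r                                      ≈⟨ A-suc n r ⟩
      A n (suc r) + α r * B n r                        ≈⟨ +-comm _ _ ⟩
      α r * B n r + A n (suc r)
        ≈⟨ +-cong (*-congˡ (B-expansion n r)) (sym (*-identityˡ _)) ⟩
      α r * ∑< (suc r) (term n r) + 1# * A n (suc r)
        ≈⟨ +-cong (*-∑< (suc r) (α r) (term n r)) (*-congʳ (reflexive (≡.sym (weight-up r)))) ⟩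
      ∑< (suc r) (λ b → α r * term n r b) + weight r (suc r) * A n (suc r)
        ≈⟨ +-congʳ (∑<-cong (suc r) (λ b b≤r → descends b (ℕ.≤-pred b≤r))) ⟩
      ∑< (suc r) (λ b → weight r b * A n b) + weight r (suc r) * A n (suc r)
        ≈⟨ ∑<-suc (suc r) (λ b → weight r b * A n b) ⟨
      ∑< (2 ℕ.+ r) (λ b → weight r b * A n b) ∎
      where
      descends : ∀ b → b ℕ.≤ r → α r * term n r b ≈ weight r b * A n b
      descends b b≤r = begin
        α r * (- ᾱ₋ b * P * A n b)
          ≈⟨ solve 4 (λ x y p a → x :* (y :* p :* a) := x :* y :* p :* a) refl (α r) (- ᾱ₋ b) P (A n b) ⟩
        α r * - ᾱ₋ b * P * A n b
          -- The minus sign returns from `ᾱ₋ b` to `α r`, its place in `descent`.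
          ≈⟨ *-congʳ (*-congʳ (trans (sym (-‿distribʳ-* _ _)) (-‿distribˡ-* _ _))) ⟩
        descent r b * A n b           ≡⟨ ≡.cong (_* A n b) (weight-down b≤r) ⟨
        weight r b * A n b            ∎
        where
        P : Carrier
        P = ∏< (r ℕ.∸ b) (λ i → ρ (b ℕ.+ i))

    A≈paths : ∀ {s h} → (∀ r → A 0 r ≈ paths 0 r s * h) → ∀ n r → A n r ≈ paths n r s * h
    A≈paths A₀ zero    r = A₀ r
    A≈paths {s} {h} A₀ (suc n) r = begin
      A (suc n) r                                            ≈⟨ A-expansion n r ⟩
      ∑< (2 ℕ.+ r) (λ b → weight r b * A n b)
        ≈⟨ ∑<-cong (2 ℕ.+ r) (λ b _ → trans (*-congˡ (A≈paths A₀ n b))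
             (solve 3 (λ w p x → w :* (p :* x) := x :* (w :* p)) refl (weight r b) (paths n b s) h)) ⟩
      ∑< (2 ℕ.+ r) (λ b → h * (weight r b * paths n b s))
        ≈⟨ *-∑< (2 ℕ.+ r) h (λ b → weight r b * paths n b s) ⟨
      h * paths (suc n) r s                                  ≈⟨ *-comm _ _ ⟩
      paths (suc n) r s * h                                  ∎

-- Exponent arithmetic for shifts and reversals.

module ℤ-Identities where
  open ℤ-Solver.+-*-Solver using (solve; _:=_; _:+_; _:-_; con)

  [j+k]-[j+l]≡k-l : ∀ j k l → (j ℤ.+ k) ℤ.- (j ℤ.+ l) ≡ k ℤ.- l
  [j+k]-[j+l]≡k-l = solve 3 (λ j k l → (j :+ k) :- (j :+ l) := k :- l) ≡.refl

  [n-k]-[n-l]≡l-k : ∀ n k l → (n ℤ.- k) ℤ.- (n ℤ.- l) ≡ l ℤ.- k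
  [n-k]-[n-l]≡l-k = solve 3 (λ n k l → (n :- k) :- (n :- l) := l :- k) ≡.refl

  [1+n]-[n-k]≡1+k : ∀ n k → (+ 1 ℤ.+ n) ℤ.- (n ℤ.- k) ≡ + 1 ℤ.+ k
  [1+n]-[n-k]≡1+k = solve 2 (λ n k → (con (+ 1) :+ n) :- (n :- k) := con (+ 1) :+ k) ≡.refl

  [1+n]+l≡n+[1+l] : ∀ n l → (+ 1 ℤ.+ n) ℤ.+ l ≡ n ℤ.+ (+ 1 ℤ.+ l)
  [1+n]+l≡n+[1+l] = solve 2 (λ n l → (con (+ 1) :+ n) :+ l := n :+ (con (+ 1) :+ l)) ≡.refl

open ℤ-Identities

-- Linear functionals on Laurent polynomials, given by moments.

module Evaluation (R : CommutativeRing 0ℓ 0ℓ) where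
  open CommutativeRing R
  open SetoidReasoning setoid
  open SemiringSolver commutativeSemiring using (solve; _:=_; _:+_; _:*_)
  open RingProperties ring
  open Sums R

  Terms : Set
  Terms = List (ℤ × Carrier)

  -- The value at f of the linear functional with moments m.
  ev : (ℤ → Carrier) → Terms → Carrier
  ev m f = sum (map (λ (k , c) → c * m k) f)

  ev-cong : ∀ {m m′} → (∀ k → m k ≈ m′ k) → ∀ f → ev m f ≈ ev m′ f
  ev-cong eq []            = refl
  ev-cong eq ((k , c) ∷ f) = +-cong (*-congˡ (eq k)) (ev-cong eq f)

  ev-++ : ∀ m f g → ev m (f ++ g) ≈ ev m f + ev m g
  ev-++ m f g = trans (reflexive (≡.cong sum (List.map-++ _ f g))) (sum-++ (map _ f) (map _ g))

  ev-·ᴸ : ∀ m d f → ev m (map (λ (k , c) → (k , d * c)) f) ≈ d * ev m f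
  ev-·ᴸ m d []            = sym (zeroʳ d)
  ev-·ᴸ m d ((k , c) ∷ f) = trans (+-cong (*-assoc d c (m k)) (ev-·ᴸ m d f)) (sym (distribˡ d _ _))

  ev--ᴸ : ∀ m f → ev m (map (λ (k , c) → (k , - c)) f) ≈ - ev m f
  ev--ᴸ m []            = sym -0#≈0#
  ev--ᴸ m ((k , c) ∷ f) = trans (+-cong (sym (-‿distribˡ-* c (m k))) (ev--ᴸ m f)) (-‿+-comm _ _)

  ev-* : ∀ m k c g → ev m (map (λ (l , d) → (k ℤ.+ l , c * d)) g) ≈ c * ev (λ l → m (k ℤ.+ l)) g
  ev-* m k c []            = sym (zeroʳ c)
  ev-* m k c ((l , d) ∷ g) = trans (+-cong (*-assoc c d _) (ev-* m k c g)) (sym (distribˡ c _ _))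

  -- A product is evaluated as an iterated sum, so its coefficients are never collected.
  ev-*ᴸ : ∀ m f g → ev m (cartesianProductWith (λ (k , c) (l , d) → (k ℤ.+ l , c * d)) f g)
                  ≈ ev (λ k → ev (λ l → m (k ℤ.+ l)) g) f
  ev-*ᴸ m []            g = refl
  ev-*ᴸ m ((k , c) ∷ f) g = trans (ev-++ m (map _ g) _) (+-cong (ev-* m k c g) (ev-*ᴸ m f g))

  ev-monomial : ∀ m k → ev m [ (k , 1#) ] ≈ m k
  ev-monomial m k = trans (+-identityʳ _) (*-identityˡ _)

  ev-0 : ∀ f → ev (λ _ → 0#) f ≈ 0#
  ev-0 []            = refl
  ev-0 ((k , c) ∷ f) = trans (+-cong (zeroʳ c) (ev-0 f)) (+-identityˡ 0#)

  ev-+ : ∀ m m′ f → ev (λ k → m k + m′ k) f ≈ ev m f + ev m′ f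
  ev-+ m m′ []            = sym (+-identityˡ 0#)
  ev-+ m m′ ((k , c) ∷ f) = trans (+-congˡ (ev-+ m m′ f))
    (solve 5 (λ c x y p q → c :* (x :+ y) :+ (p :+ q) := (c :* x :+ p) :+ (c :* y :+ q)) refl
      c (m k) (m′ k) (ev m f) (ev m′ f))

  ev-scale : ∀ d m f → ev (λ k → d * m k) f ≈ d * ev m f
  ev-scale d m []            = sym (zeroʳ d)
  ev-scale d m ((k , c) ∷ f) = trans (+-congˡ (ev-scale d m f))
    (solve 4 (λ c d x p → c :* (d :* x) :+ d :* p := d :* (c :* x :+ p)) refl c d (m k) (ev m f))

  -- Exchanging the two finite sums lets the form be read as a functional of its second argument as
  -- well as of its first.
  ev-swap : ∀ (N : ℤ → ℤ → Carrier) f g → ev (λ k → ev (N k) g) f ≈ ev (λ l → ev (λ k → N k l) f) g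
  ev-swap N []            g = sym (ev-0 g)
  ev-swap N ((k , c) ∷ f) g = begin
    c * ev (N k) g + ev (λ k → ev (N k) g) f
      ≈⟨ +-cong (sym (ev-scale c (N k) g)) (ev-swap N f g) ⟩
    ev (λ l → c * N k l) g + ev (λ l → ev (λ k → N k l) f) g
      ≈⟨ ev-+ (λ l → c * N k l) (λ l → ev (λ k → N k l) f) g ⟨
    ev (λ l → ev (λ k → N k l) ((k , c) ∷ f)) g ∎

-- Conjugation on an abstract ring, and its effect on functionals.

module _ (R : CommutativeRing 0ℓ 0ℓ) where
  open CommutativeRing R

  record IsConjugation (conj : Carrier → Carrier) : Set where
    field
      conj-cong       : ∀ {x y} → x ≈ y → conj x ≈ conj y
      conj-+          : ∀ x y → conj (x + y) ≈ conj x + conj y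
      conj-*          : ∀ x y → conj (x * y) ≈ conj x * conj y
      conj-involutive : ∀ x → conj (conj x) ≈ x

module Szegő (R : CommutativeRing 0ℓ 0ℓ)
  (conj : CommutativeRing.Carrier R → CommutativeRing.Carrier R)
  (isConjugation : IsConjugation R conj) where

  open CommutativeRing R
  open IsConjugation isConjugation
  open SetoidReasoning setoid
  open SemiringSolver commutativeSemiring using (solve; _:=_; _:+_; _:*_; con)
  open RingProperties ring
  open Evaluation R

  -- Apply multiplicativity to the product of 0 and its conjugate; involutivity turns the second
  -- factor back into 0.
  conj-0 : conj 0# ≈ 0#
  conj-0 = begin
    conj 0#                   ≈⟨ conj-cong (zeroˡ (conj 0#)) ⟨
    conj (0# * conj 0#)       ≈⟨ conj-* 0# (conj 0#) ⟩
    conj 0# * conj (conj 0#)  ≈⟨ *-congˡ (conj-involutive 0#) ⟩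
    conj 0# * 0#              ≈⟨ zeroʳ _ ⟩
    0#                        ∎

  conj-1 : conj 1# ≈ 1#
  conj-1 = begin
    conj 1#                   ≈⟨ *-identityʳ _ ⟨
    conj 1# * 1#              ≈⟨ *-congˡ (conj-involutive 1#) ⟨
    conj 1# * conj (conj 1#)  ≈⟨ conj-* 1# (conj 1#) ⟨
    conj (1# * conj 1#)       ≈⟨ conj-cong (*-identityˡ _) ⟩
    conj (conj 1#)            ≈⟨ conj-involutive 1# ⟩
    1#                        ∎

  conj-neg : ∀ x → conj (- x) ≈ - conj x
  conj-neg x = +-inverseˡ-unique _ _
    (trans (sym (conj-+ (- x) x)) (trans (conj-cong (-‿inverseˡ x)) conj-0))

  -- Conjugating the coefficients amounts to conjugating the whole value and compensating in the
  -- moments; `u` relabels the exponents and is negation in every use.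
  ev-conj : ∀ m (u : ℤ → ℤ) f →
            ev m (map (λ (k , c) → (u k , conj c)) f) ≈ conj (ev (λ k → conj (m (u k))) f)
  ev-conj m u []            = sym conj-0
  ev-conj m u ((k , c) ∷ f) = begin
    conj c * m (u k) + ev m (map _ f)
      ≈⟨ +-cong (*-congˡ (sym (conj-involutive _))) (ev-conj m u f) ⟩
    conj c * conj (conj (m (u k))) + conj (ev (λ k → conj (m (u k))) f)
      ≈⟨ +-congʳ (conj-* c (conj (m (u k)))) ⟨
    conj (c * conj (m (u k))) + conj (ev (λ k → conj (m (u k))) f)
      ≈⟨ conj-+ _ _ ⟨
    conj (ev (λ k → conj (m (u k))) ((k , c) ∷ f)) ∎

  -- Written as a product with a monomial, so that over ℂ it is definitionally `z^ j *ᴸ f`; likewise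
  -- `_†` is `_~` and `reverse` is `reversed`.
  shift : ℤ → Terms → Terms
  shift j f = cartesianProductWith (λ (k , c) (l , d) → (k ℤ.+ l , c * d)) [ (j , 1#) ] f

  _† : Terms → Terms
  f † = map (λ (k , c) → (ℤ.- k , conj c)) f

  reverse : ℕ → Terms → Terms
  reverse n f = shift (+ n) (f †)

  ev-shift : ∀ m j f → ev m (shift j f) ≈ ev (λ k → m (j ℤ.+ k)) f
  ev-shift m j f = trans (ev-*ᴸ m [ (j , 1#) ] f) (ev-monomial (λ k → ev (λ l → m (k ℤ.+ l)) f) j)

  ev-reverse : ∀ m n f → ev m (reverse n f) ≈ conj (ev (λ k → conj (m (+ n ℤ.- k))) f)
  ev-reverse m n f = trans (ev-shift m (+ n) (f †)) (ev-conj _ ℤ.-_ f)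

  -- The sesquilinear form of a moment sequence.

  module Form (M : ℤ → Carrier) where

    ⟨_,_⟩ : Terms → Terms → Carrier
    ⟨ f , g ⟩ = ev M (cartesianProductWith (λ (k , c) (l , d) → (k ℤ.+ l , c * d)) f (g †))

    -- With g fixed, the form is linear in f with moments ⟨zᵏ, g⟩; with f fixed, its conjugate is
    -- linear in g with moments the conjugates of ⟨f, zˡ⟩. Identities valid under all functionals
    -- thus apply in either argument.
    momentsˡ momentsʳ : Terms → ℤ → Carrier
    momentsˡ g k = conj (ev (λ l → conj (M (k ℤ.- l))) g)
    momentsʳ f l = conj (ev (λ k → M (k ℤ.- l)) f)

    form≈evˡ : ∀ f g → ⟨ f , g ⟩ ≈ ev (momentsˡ g) f
    form≈evˡ f g = trans (ev-*ᴸ M f (g †)) (ev-cong (λ k → ev-conj (λ l → M (k ℤ.+ l)) ℤ.-_ g) f)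

    form≈evʳ : ∀ f g → ⟨ f , g ⟩ ≈ conj (ev (momentsʳ f) g)
    form≈evʳ f g = begin
      ⟨ f , g ⟩                                          ≈⟨ ev-*ᴸ M f (g †) ⟩
      ev (λ k → ev (λ l → M (k ℤ.+ l)) (g †)) f          ≈⟨ ev-swap (λ k l → M (k ℤ.+ l)) f (g †) ⟩
      ev (λ l → ev (λ k → M (k ℤ.+ l)) f) (g †)          ≈⟨ ev-conj _ ℤ.-_ g ⟩
      conj (ev (momentsʳ f) g)                           ∎

    -- The form depends on exponents only through their differences, which a common shift preserves.
    shift-isometry : ∀ j f g → ⟨ shift j f , shift j g ⟩ ≈ ⟨ f , g ⟩
    shift-isometry j f g = begin
      ⟨ shift j f , shift j g ⟩                           ≈⟨ form≈evˡ (shift j f) (shift j g) ⟩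
      ev (momentsˡ (shift j g)) (shift j f)               ≈⟨ ev-shift _ j f ⟩
      ev (λ k → momentsˡ (shift j g) (j ℤ.+ k)) f         ≈⟨ ev-cong (λ k → conj-cong (inner k)) f ⟩
      ev (momentsˡ g) f                                   ≈⟨ form≈evˡ f g ⟨
      ⟨ f , g ⟩                                           ∎
      where
      inner : ∀ k → ev (λ l → conj (M (j ℤ.+ k ℤ.- l))) (shift j g) ≈ ev (λ l → conj (M (k ℤ.- l))) g
      inner k = trans (ev-shift _ j g) (ev-cong (λ l → conj-cong (reflexive (≡.cong M
        ([j+k]-[j+l]≡k-l j k l)))) g)

    -- Reversal conjugates coefficients and sends the exponent k to n - k, so differences of
    -- exponents change sign and the two arguments trade roles.
    reverse-swap : ∀ n f g → ⟨ reverse n f , reverse n g ⟩ ≈ ⟨ g , f ⟩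
    reverse-swap n f g = begin
      ⟨ reverse n f , reverse n g ⟩
        ≈⟨ form≈evˡ (reverse n f) (reverse n g) ⟩
      ev (momentsˡ (reverse n g)) (reverse n f)                           ≈⟨ ev-reverse _ n f ⟩
      conj (ev (λ k → conj (momentsˡ (reverse n g) (+ n ℤ.- k))) f)
        ≈⟨ conj-cong (ev-cong (λ k → conj-cong (inner k)) f) ⟩
      conj (ev (momentsʳ g) f)                                            ≈⟨ form≈evʳ g f ⟨
      ⟨ g , f ⟩                                                           ∎
      where
      inner : ∀ k → momentsˡ (reverse n g) (+ n ℤ.- k) ≈ ev (λ l → M (l ℤ.- k)) g
      inner k = begin
        conj (ev (λ l → conj (M (+ n ℤ.- k ℤ.- l))) (reverse n g))        ≈⟨ conj-cong (ev-reverse _ n g) ⟩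
        conj (conj (ev (λ l → conj (conj (M (+ n ℤ.- k ℤ.- (+ n ℤ.- l))))) g)) ≈⟨ conj-involutive _ ⟩
        ev (λ l → conj (conj (M (+ n ℤ.- k ℤ.- (+ n ℤ.- l))))) g
          ≈⟨ ev-cong (λ l → trans (conj-involutive _) (reflexive (≡.cong M
               ([n-k]-[n-l]≡l-k (+ n) k l)))) g ⟩
        ev (λ l → M (l ℤ.- k)) g                                          ∎

  -- Szegő's recursion and its reversal.

  module Recurrence (α ρ : ℕ → Carrier) (ρ≈ : ∀ n → ρ n ≈ 1# + - (α n * conj (α n)))
    (φ : ℕ → Terms) (φ-zero : ∀ m → ev m (φ 0) ≈ m (+ 0))
    (φ-suc : ∀ n m → ev m (φ (suc n))
                   ≈ ev m (shift (+ 1) (φ n)) + - conj (α n) * ev m (reverse n (φ n)))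
    where

    φ* : ℕ → Terms
    φ* n = reverse n (φ n)

    zφ : ℕ → Terms
    zφ n = shift (+ 1) (φ n)

    φ*-zero : ∀ m → ev m (φ* 0) ≈ ev m (φ 0)
    φ*-zero m = begin
      ev m (reverse 0 (φ 0))                          ≈⟨ ev-reverse m 0 (φ 0) ⟩
      conj (ev (λ k → conj (m (+ 0 ℤ.- k))) (φ 0))    ≈⟨ conj-cong (φ-zero _) ⟩
      conj (conj (m (+ 0)))                           ≈⟨ conj-involutive _ ⟩
      m (+ 0)                                         ≈⟨ φ-zero m ⟨
      ev m (φ 0)                                      ∎

    zφ≈ : ∀ n m → ev m (zφ n) ≈ ev m (φ (suc n)) + conj (α n) * ev m (φ* n)
    zφ≈ n m = sym (begin
      ev m (φ (suc n)) + ᾱ * y             ≈⟨ +-congʳ (φ-suc n m) ⟩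
      ev m (zφ n) + - ᾱ * y + ᾱ * y
        ≈⟨ solve 4 (λ x b a y → x :+ b :* y :+ a :* y := x :+ (b :+ a) :* y) refl
             (ev m (zφ n)) (- ᾱ) ᾱ y ⟩
      ev m (zφ n) + (- ᾱ + ᾱ) * y          ≈⟨ +-congˡ (trans (*-congʳ (-‿inverseˡ ᾱ)) (zeroˡ y)) ⟩
      ev m (zφ n) + 0#                     ≈⟨ +-identityʳ _ ⟩
      ev m (zφ n)                          ∎)
      where
      ᾱ y : Carrier
      ᾱ = conj (α n)
      y = ev m (φ* n)

    -- Reversing the recursion at degree n + 1 exchanges its two terms: zφₙ becomes φₙ*, and φₙ*
    -- becomes zφₙ.
    φ*-suc′ : ∀ n m → ev m (φ* (suc n)) ≈ ev m (φ* n) + - α n * ev m (zφ n)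
    φ*-suc′ n m = begin
      ev m (φ* (suc n))                                     ≈⟨ ev-reverse m (suc n) (φ (suc n)) ⟩
      conj (ev m′ (φ (suc n)))                              ≈⟨ conj-cong (φ-suc n m′) ⟩
      conj (ev m′ (zφ n) + - conj (α n) * ev m′ (φ* n))     ≈⟨ conj-+ _ _ ⟩
      conj (ev m′ (zφ n)) + conj (- conj (α n) * ev m′ (φ* n))
        ≈⟨ +-cong (conj-cong first)
             (trans (conj-* _ _) (*-cong (trans (conj-neg _) (-‿cong (conj-involutive _))) second)) ⟩
      conj (ev (λ k → conj (m (+ n ℤ.- k))) (φ n)) + - α n * ev m (zφ n)
        ≈⟨ +-congʳ (ev-reverse m n (φ n)) ⟨
      ev m (φ* n) + - α n * ev m (zφ n)                     ∎
      where
      m′ : ℤ → Carrier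
      m′ k = conj (m (+ suc n ℤ.- k))

      first : ev m′ (zφ n) ≈ ev (λ k → conj (m (+ n ℤ.- k))) (φ n)
      first = trans (ev-shift m′ (+ 1) (φ n)) (ev-cong (λ k → conj-cong (reflexive (≡.cong m
        ([j+k]-[j+l]≡k-l (+ 1) (+ n) k)))) (φ n))

      second : conj (ev m′ (φ* n)) ≈ ev m (zφ n)
      second = begin
        conj (ev m′ (φ* n))                                                 ≈⟨ conj-cong (ev-reverse m′ n (φ n)) ⟩
        conj (conj (ev (λ k → conj (m′ (+ n ℤ.- k))) (φ n)))                ≈⟨ conj-involutive _ ⟩
        ev (λ k → conj (m′ (+ n ℤ.- k))) (φ n)
          ≈⟨ ev-cong (λ k → trans (conj-involutive _) (reflexive (≡.cong m
               ([1+n]-[n-k]≡1+k (+ n) k)))) (φ n) ⟩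
        ev (λ k → m (+ 1 ℤ.+ k)) (φ n)                                      ≈⟨ ev-shift m (+ 1) (φ n) ⟨
        ev m (zφ n)                                                         ∎

    -- Eliminating zφₙ from the reversed recursion collects 1 - αₙ ᾱₙ in front of φₙ*.
    φ*-suc : ∀ n m → ev m (φ* (suc n)) ≈ ρ n * ev m (φ* n) + - α n * ev m (φ (suc n))
    φ*-suc n m = begin
      ev m (φ* (suc n))                                       ≈⟨ φ*-suc′ n m ⟩
      y + - α n * ev m (zφ n)                                 ≈⟨ +-congˡ (*-congˡ (zφ≈ n m)) ⟩
      y + - α n * (x + conj (α n) * y)
        ≈⟨ solve 4 (λ a b x y → y :+ a :* (x :+ b :* y) := (con 1 :+ a :* b) :* y :+ a :* x) refl
             (- α n) (conj (α n)) x y ⟩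
      (1# + - α n * conj (α n)) * y + - α n * x
        ≈⟨ +-congʳ (*-congʳ (+-congˡ (sym (-‿distribˡ-* _ _)))) ⟩
      (1# + - (α n * conj (α n))) * y + - α n * x             ≈⟨ +-congʳ (*-congʳ (ρ≈ n)) ⟨
      ρ n * y + - α n * x                                     ∎
      where
      x y : Carrier
      x = ev m (φ (suc n))
      y = ev m (φ* n)

    conj-ρ : ∀ n → conj (ρ n) ≈ ρ n
    conj-ρ n = begin
      conj (ρ n)                                      ≈⟨ conj-cong (ρ≈ n) ⟩
      conj (1# + - (α n * conj (α n)))                ≈⟨ conj-+ _ _ ⟩
      conj 1# + conj (- (α n * conj (α n)))           ≈⟨ +-cong conj-1 (conj-neg _) ⟩
      1# + - conj (α n * conj (α n))                  ≈⟨ +-congˡ (-‿cong (conj-* _ _)) ⟩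
      1# + - (conj (α n) * conj (conj (α n)))         ≈⟨ +-congˡ (-‿cong (*-congˡ (conj-involutive _))) ⟩
      1# + - (conj (α n) * α n)                       ≈⟨ +-congˡ (-‿cong (*-comm _ _)) ⟩
      1# + - (α n * conj (α n))                       ≈⟨ ρ≈ n ⟨
      ρ n                                             ∎

    -- The conjugated recursions serve the second argument of the form, in which it is
    -- conjugate-linear.
    conj-φ*-suc : ∀ n m → conj (ev m (φ* (suc n)))
                        ≈ ρ n * conj (ev m (φ* n)) + - conj (α n) * conj (ev m (φ (suc n)))
    conj-φ*-suc n m = begin
      conj (ev m (φ* (suc n)))                                            ≈⟨ conj-cong (φ*-suc n m) ⟩
      conj (ρ n * ev m (φ* n) + - α n * ev m (φ (suc n)))                 ≈⟨ conj-+ _ _ ⟩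
      conj (ρ n * ev m (φ* n)) + conj (- α n * ev m (φ (suc n)))          ≈⟨ +-cong (conj-* _ _) (conj-* _ _) ⟩
      conj (ρ n) * conj (ev m (φ* n)) + conj (- α n) * conj (ev m (φ (suc n)))
        ≈⟨ +-cong (*-congʳ (conj-ρ n)) (*-congʳ (conj-neg _)) ⟩
      ρ n * conj (ev m (φ* n)) + - conj (α n) * conj (ev m (φ (suc n)))   ∎

    conj-zφ : ∀ n m → conj (ev m (zφ n)) ≈ conj (ev m (φ (suc n))) + α n * conj (ev m (φ* n))
    conj-zφ n m = begin
      conj (ev m (zφ n))                                                  ≈⟨ conj-cong (zφ≈ n m) ⟩
      conj (ev m (φ (suc n)) + conj (α n) * ev m (φ* n))                  ≈⟨ conj-+ _ _ ⟩
      conj (ev m (φ (suc n))) + conj (conj (α n) * ev m (φ* n))           ≈⟨ +-congˡ (conj-* _ _) ⟩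
      conj (ev m (φ (suc n))) + conj (conj (α n)) * conj (ev m (φ* n))    ≈⟨ +-congˡ (*-congʳ (conj-involutive _)) ⟩
      conj (ev m (φ (suc n))) + α n * conj (ev m (φ* n))                  ∎

    -- Recursions for the shifted inner products.

    module _ (M : ℤ → Carrier) where
      open Form M

      module _ (s : ℕ) where

        A B : ℕ → ℕ → Carrier
        A n r = ⟨ φ s , shift (+ n) (φ r) ⟩
        B n r = ⟨ φ s , shift (+ n) (φ* r) ⟩

        -- These are the moments of the conjugate of ⟨φₛ, zⁿ f⟩, a linear functional of f.
        shifted : ℕ → ℤ → Carrier
        shifted n l = momentsʳ (φ s) (+ n ℤ.+ l)

        form-shift : ∀ n f → ⟨ φ s , shift (+ n) f ⟩ ≈ conj (ev (shifted n) f)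
        form-shift n f = trans (form≈evʳ (φ s) (shift (+ n) f)) (conj-cong (ev-shift _ (+ n) f))

        A-suc : ∀ n r → A (suc n) r ≈ A n (suc r) + α r * B n r
        A-suc n r = begin
          A (suc n) r                                                    ≈⟨ form-shift (suc n) (φ r) ⟩
          conj (ev (shifted (suc n)) (φ r))
            ≈⟨ conj-cong (ev-cong (λ l →
                 reflexive (≡.cong (momentsʳ (φ s)) ([1+n]+l≡n+[1+l] (+ n) l))) (φ r)) ⟩
          conj (ev (λ l → shifted n (+ 1 ℤ.+ l)) (φ r))                  ≈⟨ conj-cong (ev-shift _ (+ 1) (φ r)) ⟨
          conj (ev (shifted n) (zφ r))                                   ≈⟨ conj-zφ r (shifted n) ⟩
          conj (ev (shifted n) (φ (suc r))) + α r * conj (ev (shifted n) (φ* r))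
            ≈⟨ +-cong (form-shift n (φ (suc r))) (*-congˡ (form-shift n (φ* r))) ⟨
          A n (suc r) + α r * B n r                                      ∎

        B-zero : ∀ n → B n 0 ≈ A n 0
        B-zero n = begin
          B n 0                           ≈⟨ form-shift n (φ* 0) ⟩
          conj (ev (shifted n) (φ* 0))    ≈⟨ conj-cong (φ*-zero (shifted n)) ⟩
          conj (ev (shifted n) (φ 0))     ≈⟨ form-shift n (φ 0) ⟨
          A n 0                           ∎

        B-suc : ∀ n r → B n (suc r) ≈ ρ r * B n r + - conj (α r) * A n (suc r)
        B-suc n r = begin
          B n (suc r)                             ≈⟨ form-shift n (φ* (suc r)) ⟩
          conj (ev (shifted n) (φ* (suc r)))      ≈⟨ conj-φ*-suc r (shifted n) ⟩
          ρ r * conj (ev (shifted n) (φ* r)) + - conj (α r) * conj (ev (shifted n) (φ (suc r)))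
            ≈⟨ +-cong (*-congˡ (form-shift n (φ* r))) (*-congˡ (form-shift n (φ (suc r)))) ⟨
          ρ r * B n r + - conj (α r) * A n (suc r) ∎

        A-zero : ∀ r → A 0 r ≈ ⟨ φ s , φ r ⟩
        A-zero r = begin
          A 0 r                                   ≈⟨ form-shift 0 (φ r) ⟩
          conj (ev (shifted 0) (φ r))
            ≈⟨ conj-cong (ev-cong (λ l →
                 reflexive (≡.cong (momentsʳ (φ s)) (ℤ.+-identityˡ l))) (φ r)) ⟩
          conj (ev (momentsʳ (φ s)) (φ r))        ≈⟨ form≈evʳ (φ s) (φ r) ⟨
          ⟨ φ s , φ r ⟩                           ∎

      -- Orthogonality to the reversed polynomials, and norms.

      module _ (orthogonal : ∀ m n → m ≢ n → ⟨ φ m , φ n ⟩ ≈ 0#) where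

        -- By `φ*-suc`, φⱼ* is a combination of φ₀, ..., φⱼ, all orthogonal to φₖ when j < k.
        orthogonalˡ : ∀ j {k} → j ℕ.< k → ⟨ φ* j , φ k ⟩ ≈ 0#
        orthogonalˡ zero {k} 0<k = begin
          ⟨ φ* 0 , φ k ⟩             ≈⟨ form≈evˡ (φ* 0) (φ k) ⟩
          ev (momentsˡ (φ k)) (φ* 0) ≈⟨ φ*-zero _ ⟩
          ev (momentsˡ (φ k)) (φ 0)  ≈⟨ form≈evˡ (φ 0) (φ k) ⟨
          ⟨ φ 0 , φ k ⟩              ≈⟨ orthogonal 0 k (ℕ.<⇒≢ 0<k) ⟩
          0#                         ∎
        orthogonalˡ (suc j) {k} 1+j<k = begin
          ⟨ φ* (suc j) , φ k ⟩             ≈⟨ form≈evˡ (φ* (suc j)) (φ k) ⟩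
          ev (momentsˡ (φ k)) (φ* (suc j)) ≈⟨ φ*-suc j _ ⟩
          ρ j * ev (momentsˡ (φ k)) (φ* j) + - α j * ev (momentsˡ (φ k)) (φ (suc j))
            ≈⟨ +-cong (*-congˡ (form≈evˡ (φ* j) (φ k))) (*-congˡ (form≈evˡ (φ (suc j)) (φ k))) ⟨
          ρ j * ⟨ φ* j , φ k ⟩ + - α j * ⟨ φ (suc j) , φ k ⟩
            ≈⟨ +-cong (*-congˡ (orthogonalˡ j (ℕ.<-trans (ℕ.n<1+n j) 1+j<k)))
                      (*-congˡ (orthogonal (suc j) k (ℕ.<⇒≢ 1+j<k))) ⟩
          ρ j * 0# + - α j * 0#            ≈⟨ +-cong (zeroʳ _) (zeroʳ _) ⟩
          0# + 0#                          ≈⟨ +-identityˡ _ ⟩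
          0#                               ∎

        -- The same induction in the second argument, through `conj-φ*-suc`, as no Hermitian
        -- symmetry of the form has been established.
        orthogonalʳ : ∀ j {k} → j ℕ.< k → ⟨ φ k , φ* j ⟩ ≈ 0#
        orthogonalʳ zero {k} 0<k = begin
          ⟨ φ k , φ* 0 ⟩                    ≈⟨ form≈evʳ (φ k) (φ* 0) ⟩
          conj (ev (momentsʳ (φ k)) (φ* 0)) ≈⟨ conj-cong (φ*-zero _) ⟩
          conj (ev (momentsʳ (φ k)) (φ 0))  ≈⟨ form≈evʳ (φ k) (φ 0) ⟨
          ⟨ φ k , φ 0 ⟩                     ≈⟨ orthogonal k 0 (ℕ.>⇒≢ 0<k) ⟩
          0#                                ∎
        orthogonalʳ (suc j) {k} 1+j<k = begin
          ⟨ φ k , φ* (suc j) ⟩                    ≈⟨ form≈evʳ (φ k) (φ* (suc j)) ⟩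
          conj (ev (momentsʳ (φ k)) (φ* (suc j))) ≈⟨ conj-φ*-suc j _ ⟩
          ρ j * conj (ev (momentsʳ (φ k)) (φ* j)) + - conj (α j) * conj (ev (momentsʳ (φ k)) (φ (suc j)))
            ≈⟨ +-cong (*-congˡ (form≈evʳ (φ k) (φ* j))) (*-congˡ (form≈evʳ (φ k) (φ (suc j)))) ⟨
          ρ j * ⟨ φ k , φ* j ⟩ + - conj (α j) * ⟨ φ k , φ (suc j) ⟩
            ≈⟨ +-cong (*-congˡ (orthogonalʳ j (ℕ.<-trans (ℕ.n<1+n j) 1+j<k)))
                      (*-congˡ (orthogonal k (suc j) (ℕ.>⇒≢ 1+j<k))) ⟩
          ρ j * 0# + - conj (α j) * 0#            ≈⟨ +-cong (zeroʳ _) (zeroʳ _) ⟩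
          0# + 0#                                 ≈⟨ +-identityˡ _ ⟩
          0#                                      ∎

        -- zφₙ splits into φₙ₊₁, orthogonal to φₙ*, and a multiple of φₙ*, whose norm is that of φₙ
        -- by `reverse-swap`.
        zφ-φ* : ∀ n → ⟨ zφ n , φ* n ⟩ ≈ conj (α n) * ⟨ φ n , φ n ⟩
        zφ-φ* n = begin
          ⟨ zφ n , φ* n ⟩                    ≈⟨ form≈evˡ (zφ n) (φ* n) ⟩
          ev (momentsˡ (φ* n)) (zφ n)        ≈⟨ zφ≈ n _ ⟩
          ev (momentsˡ (φ* n)) (φ (suc n)) + conj (α n) * ev (momentsˡ (φ* n)) (φ* n)
            ≈⟨ +-cong (form≈evˡ (φ (suc n)) (φ* n)) (*-congˡ (form≈evˡ (φ* n) (φ* n))) ⟨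
          ⟨ φ (suc n) , φ* n ⟩ + conj (α n) * ⟨ φ* n , φ* n ⟩
            ≈⟨ +-cong (orthogonalʳ n (ℕ.n<1+n n)) (*-congˡ (reverse-swap n (φ n) (φ n))) ⟩
          0# + conj (α n) * ⟨ φ n , φ n ⟩    ≈⟨ +-identityˡ _ ⟩
          conj (α n) * ⟨ φ n , φ n ⟩         ∎

        -- Expanding the second argument gives ⟨zφₙ, zφₙ⟩, where the shift is an isometry, minus αₙ
        -- times the inner product of `zφ-φ*`.
        zφ-φ-suc : ∀ n → ⟨ zφ n , φ (suc n) ⟩ ≈ ρ n * ⟨ φ n , φ n ⟩
        zφ-φ-suc n = begin
          ⟨ zφ n , φ (suc n) ⟩                       ≈⟨ form≈evʳ (zφ n) (φ (suc n)) ⟩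
          conj (ev N (φ (suc n)))                    ≈⟨ conj-cong (φ-suc n N) ⟩
          conj (ev N (zφ n) + - conj (α n) * ev N (φ* n))                  ≈⟨ conj-+ _ _ ⟩
          conj (ev N (zφ n)) + conj (- conj (α n) * ev N (φ* n))
            ≈⟨ +-congˡ (trans (conj-* _ _) (*-congʳ (trans (conj-neg _) (-‿cong (conj-involutive _))))) ⟩
          conj (ev N (zφ n)) + - α n * conj (ev N (φ* n))
            ≈⟨ +-cong (form≈evʳ (zφ n) (zφ n)) (*-congˡ (form≈evʳ (zφ n) (φ* n))) ⟨
          ⟨ zφ n , zφ n ⟩ + - α n * ⟨ zφ n , φ* n ⟩
            ≈⟨ +-cong (shift-isometry (+ 1) (φ n) (φ n)) (*-congˡ (zφ-φ* n)) ⟩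
          h + - α n * (conj (α n) * h)
            ≈⟨ +-cong (sym (*-identityˡ h))
                 (trans (sym (*-assoc _ _ _)) (*-congʳ (sym (-‿distribˡ-* _ _)))) ⟩
          1# * h + - (α n * conj (α n)) * h          ≈⟨ distribʳ h _ _ ⟨
          (1# + - (α n * conj (α n))) * h            ≈⟨ *-congʳ (ρ≈ n) ⟨
          ρ n * h                                    ∎
          where
          N : ℤ → Carrier
          N = momentsʳ (zφ n)
          h : Carrier
          h = ⟨ φ n , φ n ⟩

        -- Only the first argument is expanded: its φₙ* part is orthogonal to φₙ₊₁.
        norm-suc : ∀ n → ⟨ φ (suc n) , φ (suc n) ⟩ ≈ ρ n * ⟨ φ n , φ n ⟩
        norm-suc n = begin
          ⟨ φ (suc n) , φ (suc n) ⟩                   ≈⟨ form≈evˡ (φ (suc n)) (φ (suc n)) ⟩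
          ev N (φ (suc n))                            ≈⟨ φ-suc n N ⟩
          ev N (zφ n) + - conj (α n) * ev N (φ* n)
            ≈⟨ +-cong (form≈evˡ (zφ n) (φ (suc n))) (*-congˡ (form≈evˡ (φ* n) (φ (suc n)))) ⟨
          ⟨ zφ n , φ (suc n) ⟩ + - conj (α n) * ⟨ φ* n , φ (suc n) ⟩
            ≈⟨ +-cong (zφ-φ-suc n) (trans (*-congˡ (orthogonalˡ n (ℕ.n<1+n n))) (zeroʳ _)) ⟩
          ρ n * ⟨ φ n , φ n ⟩ + 0#                    ≈⟨ +-identityʳ _ ⟩
          ρ n * ⟨ φ n , φ n ⟩                         ∎
          where
          N : ℤ → Carrier
          N = momentsˡ (φ (suc n))

        norm-zero : ⟨ φ 0 , φ 0 ⟩ ≈ M (+ 0)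
        norm-zero = begin
          ⟨ φ 0 , φ 0 ⟩                       ≈⟨ form≈evˡ (φ 0) (φ 0) ⟩
          ev (momentsˡ (φ 0)) (φ 0)           ≈⟨ φ-zero _ ⟩
          conj (ev (λ l → conj (M (+ 0 ℤ.- l))) (φ 0)) ≈⟨ conj-cong (φ-zero _) ⟩
          conj (conj (M (+ 0)))               ≈⟨ conj-involutive _ ⟩
          M (+ 0)                             ∎

-- Specialization to the complex numbers.

-- The equality of ℂ unfolds to its ε-definition, from which Agda cannot recover the
-- complex numbers compared; hence the explicit implicit arguments below, and the
-- abstract ring R above.
module OrthogonalPolynomials where
  open ComplexNumbers
  open CommutativeRing ℂ-commutativeRing
  open RingProperties ring using (-‿distribˡ-*)
  open SetoidReasoning setoid
  open Sums ℂ-commutativeRing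
  open Evaluation ℂ-commutativeRing

  conj-isConjugation : IsConjugation ℂ-commutativeRing conj
  conj-isConjugation = record
    { conj-cong       = λ {w} {z} → conj-cong {w} {z}
    ; conj-+          = conj-+
    ; conj-*          = conj-*
    ; conj-involutive = conj-involutive
    }

  open Szegő ℂ-commutativeRing conj conj-isConjugation

  module _ (α : ℕ → ℂ) where

    ρ : ℕ → ℂ
    ρ n = 1ᶜ - ofReal ∣ α n ∣²

    ρ≈ : ∀ n → ρ n ≈ 1ᶜ - α n * conj (α n)
    ρ≈ n = +-congˡ {1ᶜ} { - ofReal ∣ α n ∣²} { - (α n * conj (α n))}
      (-‿cong {ofReal ∣ α n ∣²} {α n * conj (α n)}
        (sym {α n * conj (α n)} {ofReal ∣ α n ∣²} (z*conj-z (α n))))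

    Φ-zero : ∀ m → ev m (Φ α 0) ≈ m (+ 0)
    Φ-zero m = ev-monomial m (+ 0)

    Φ-suc : ∀ n m → ev m (Φ α (suc n)) ≈
            ev m (shift (+ 1) (Φ α n)) + - conj (α n) * ev m (reverse n (Φ α n))
    Φ-suc n m = begin
      ev m (zΦ ++ -ᴸ (ᾱ ·ᴸ Φ*))         ≈⟨ ev-++ m zΦ (-ᴸ (ᾱ ·ᴸ Φ*)) ⟩
      ev m zΦ + ev m (-ᴸ (ᾱ ·ᴸ Φ*))
        ≈⟨ +-congˡ {ev m zΦ} {ev m (-ᴸ (ᾱ ·ᴸ Φ*))} { - ev m (ᾱ ·ᴸ Φ*)} (ev--ᴸ m (ᾱ ·ᴸ Φ*)) ⟩
      ev m zΦ + - ev m (ᾱ ·ᴸ Φ*)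
        ≈⟨ +-congˡ {ev m zΦ} { - ev m (ᾱ ·ᴸ Φ*)} { - (ᾱ * ev m Φ*)}
             (-‿cong {ev m (ᾱ ·ᴸ Φ*)} {ᾱ * ev m Φ*} (ev-·ᴸ m ᾱ Φ*)) ⟩
      ev m zΦ + - (ᾱ * ev m Φ*)
        ≈⟨ +-congˡ {ev m zΦ} { - (ᾱ * ev m Φ*)} { - ᾱ * ev m Φ*} (-‿distribˡ-* ᾱ (ev m Φ*)) ⟩
      ev m zΦ + - ᾱ * ev m Φ*           ∎
      where
      ᾱ : ℂ
      ᾱ = conj (α n)
      zΦ Φ* : Laurent
      zΦ = z^ (+ 1) *ᴸ Φ α n
      Φ* = reversed n (Φ α n)

    conj-before-zero : conj (before α 0) ≈ - 1ᶜ
    conj-before-zero = trans {conj (- 1ᶜ)} { - conj 1ᶜ} { - 1ᶜ}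
      (conj-neg 1ᶜ) (-‿cong {conj 1ᶜ} {1ᶜ} conj-1)

    -- From enumerated paths to the path recursion.

    open Łukasiewicz ℂ-commutativeRing α (conj ∘ α) (conj ∘ before α) ρ

    -- `wt` reads the first step only once the second point is known; the case split on n exposes
    -- the head (k, b) shared by all these paths.
    ∑-wt-∷ : ∀ P k n b s → ∑ (map (λ p → wt α (P ∷ p)) (pathsFrom k n b s))
                         ≈ stepWeight α P (+ k , b) * ∑ (map (wt α) (pathsFrom k n b s))
    ∑-wt-∷ P k zero b s with b ℕ.≟ s
    -- A one-point path has weight 1, so a dummy list with as many entries as there are paths, here
    -- one and below none, gives the claim.
    ... | yes _ = sum-map-* (stepWeight α P (+ k , b)) (λ (_ : ℕ) → 1ᶜ) [ 0 ]
    ... | no  _ = sum-map-* (stepWeight α P (+ k , b)) (λ (_ : ℕ) → 1ᶜ) []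
    ∑-wt-∷ P k (suc n) b s = begin
      ∑ (map (λ p → wt α (P ∷ p)) (map ((+ k , b) ∷_) paths′))
        ≡⟨ ≡.cong ∑ (List.map-∘ {g = λ p → wt α (P ∷ p)} {f = (+ k , b) ∷_} paths′) ⟨
      ∑ (map (λ p → w * wt α ((+ k , b) ∷ p)) paths′)
        ≈⟨ sum-map-* w (λ p → wt α ((+ k , b) ∷ p)) paths′ ⟩
      w * ∑ (map (λ p → wt α ((+ k , b) ∷ p)) paths′)
        ≡⟨ ≡.cong (λ xs → w * ∑ xs) (List.map-∘ {g = wt α} {f = (+ k , b) ∷_} paths′) ⟩
      w * ∑ (map (wt α) (map ((+ k , b) ∷_) paths′)) ∎
      where
      w : ℂ
      w = stepWeight α P (+ k , b)
      paths′ : List (List Point)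
      paths′ = concatMap (λ b′ → pathsFrom (suc k) n b′ s) (upTo (2 ℕ.+ b))

    -- Grouping paths by the end of their first step yields the recursion of `paths`; the factor
    -- `stepWeight` is `weight` by definition.
    ∑-wt≈paths : ∀ k n r s → ∑ (map (wt α) (pathsFrom k n r s)) ≈ paths n r s
    ∑-wt≈paths k zero r s with r ℕ.≟ s
    ... | yes r≡s rewrite dec-true  (r ℕ.≟ s) r≡s = +-identityʳ 1ᶜ
    ... | no  r≢s rewrite dec-false (r ℕ.≟ s) r≢s = refl {0ᶜ}
    ∑-wt≈paths k (suc n) r s = begin
      ∑ (map (wt α) (map ((+ k , r) ∷_) (concatMap rest (upTo (2 ℕ.+ r)))))
        ≡⟨ ≡.cong ∑ (List.map-∘ {g = wt α} {f = (+ k , r) ∷_} (concatMap rest (upTo (2 ℕ.+ r)))) ⟨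
      ∑ (map (λ p → wt α ((+ k , r) ∷ p)) (concatMap rest (upTo (2 ℕ.+ r))))
        ≈⟨ sum-concatMap (λ p → wt α ((+ k , r) ∷ p)) rest (upTo (2 ℕ.+ r)) ⟩
      ∑< (2 ℕ.+ r) (λ b → ∑ (map (λ p → wt α ((+ k , r) ∷ p)) (rest b)))
        ≈⟨ sum-cong {f = λ b → ∑ (map (λ p → wt α ((+ k , r) ∷ p)) (rest b))}
             {g = λ b → weight r b * paths n b s} perStep (upTo (2 ℕ.+ r)) ⟩
      paths (suc n) r s ∎
      where
      rest : ℕ → List (List Point)
      rest b = pathsFrom (suc k) n b s

      perStep : ∀ b → ∑ (map (λ p → wt α ((+ k , r) ∷ p)) (rest b)) ≈ weight r b * paths n b s
      perStep b = trans {∑ (map (λ p → wt α ((+ k , r) ∷ p)) (rest b))}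
                     {weight r b * ∑ (map (wt α) (rest b))} {weight r b * paths n b s}
        (∑-wt-∷ (+ k , r) (suc k) n b s)
        (*-congˡ {weight r b} {∑ (map (wt α) (rest b))} {paths n b s} (∑-wt≈paths (suc k) n b s))

    -- The moment functional, its norms and the expansion.

    module _ (𝓛 : Laurent → ℂ) (isMoment : IsMomentFunctional α 𝓛) where
      open IsMomentFunctional isMoment
      open ModuleMorphisms.LeftModuleMorphisms.IsLeftModuleHomomorphism linear

      M : ℤ → ℂ
      M k = 𝓛 (z^ k)

      open Form M
      open Recurrence α ρ ρ≈ (Φ α) Φ-zero Φ-suc

      -- Homogeneity speaks of `c ·ᴸ z^ k`, whose coefficient is c times 1, so a list entry must
      -- first be identified with it.
      coefficient-monomial : ∀ k c → [ (k , c) ] ≈ᴸ c ·ᴸ z^ k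
      coefficient-monomial k c j =
        +-congʳ {0ᶜ} {if b then c else 0ᶜ} {if b then c * 1ᶜ else 0ᶜ} (branches b)
        where
        b : Bool
        b = does (j ℤ.≟ k)
        branches : ∀ b → (if b then c else 0ᶜ) ≈ (if b then c * 1ᶜ else 0ᶜ)
        branches true  = sym {c * 1ᶜ} {c} (*-identityʳ c)
        branches false = refl {0ᶜ}

      -- Linearity determines 𝓛 by its moments, which transfers the results on `ev` to 𝓛.
      𝓛≈ev : ∀ f → 𝓛 f ≈ ev M f
      𝓛≈ev []            = 0ᴹ-homo
      𝓛≈ev ((k , c) ∷ f) = begin
        𝓛 ([ (k , c) ] +ᴸ f)         ≈⟨ +ᴹ-homo [ (k , c) ] f ⟩
        𝓛 [ (k , c) ] + 𝓛 f
          ≈⟨ +-cong {𝓛 [ (k , c) ]} {𝓛 (c ·ᴸ z^ k)} {𝓛 f} {ev M f}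
               (⟦⟧-cong {[ (k , c) ]} {c ·ᴸ z^ k} (coefficient-monomial k c)) (𝓛≈ev f) ⟩
        𝓛 (c ·ᴸ z^ k) + ev M f       ≈⟨ +-congʳ {ev M f} {𝓛 (c ·ᴸ z^ k)} {c * M k} (*ₗ-homo c (z^ k)) ⟩
        c * M k + ev M f             ∎

      orthogonal′ : ∀ m n → m ≢ n → ⟨ Φ α m , Φ α n ⟩ ≈ 0ᶜ
      orthogonal′ m n m≢n = trans {⟨ Φ α m , Φ α n ⟩} {⟨ Φ α m , Φ α n ⟩[ 𝓛 ]} {0ᶜ}
        (sym {⟨ Φ α m , Φ α n ⟩[ 𝓛 ]} {⟨ Φ α m , Φ α n ⟩} (𝓛≈ev (Φ α m *ᴸ Φ α n ~)))
        (orthogonal m n m≢n)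

      -- The product of 1 - |αⱼ|² over j < n, kept as a real number so that positivity can be proved
      -- factor by factor.
      norm : ℕ → ℝ
      norm zero    = 1ᴿ
      norm (suc n) = (1ᴿ +ᴿ -ᴿ ∣ α n ∣²) *ᴿ norm n

      ⟨Φ,Φ⟩≈norm : ∀ n → ⟨ Φ α n , Φ α n ⟩ ≈ ofReal (norm n)
      ⟨Φ,Φ⟩≈norm zero = trans {⟨ Φ α 0 , Φ α 0 ⟩} {M (+ 0)} {1ᶜ}
        (norm-zero M orthogonal′) normalized
      ⟨Φ,Φ⟩≈norm (suc n) = begin
        ⟨ Φ α (suc n) , Φ α (suc n) ⟩                    ≈⟨ norm-suc M orthogonal′ n ⟩
        ρ n * ⟨ Φ α n , Φ α n ⟩
          ≈⟨ *-cong {ρ n} {ofReal (1ᴿ +ᴿ -ᴿ ∣ α n ∣²)} {⟨ Φ α n , Φ α n ⟩} {ofReal (norm n)}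
               (sym {ofReal (1ᴿ +ᴿ -ᴿ ∣ α n ∣²)} {ρ n} (ofReal-1- ∣ α n ∣²)) (⟨Φ,Φ⟩≈norm n) ⟩
        ofReal (1ᴿ +ᴿ -ᴿ ∣ α n ∣²) * ofReal (norm n)     ≈⟨ ofReal-* (1ᴿ +ᴿ -ᴿ ∣ α n ∣²) (norm n) ⟨
        ofReal (norm (suc n))                            ∎

      norm-positive : (∀ n → ∣ α n ∣< 1ᴿ) → ∀ n → 0ᴿ <ᴿ norm n
      norm-positive α<1 zero    = 1-positive
      norm-positive α<1 (suc n) = *-positive {1ᴿ +ᴿ -ᴿ ∣ α n ∣²} {norm n}
        (1-∣z∣²-positive {α n} (α<1 n)) (norm-positive α<1 n)

      expand : ∀ n r s → ⟨ Φ α s , z^ (+ n) *ᴸ Φ α r ⟩ ≈ paths n r s * ⟨ Φ α s , Φ α s ⟩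
      expand n r s = A≈paths conj-before-zero (λ n → refl {conj (α n)})
        (A M s) (B M s) (A-suc M s) (B-zero M s) (B-suc M s) {s} {⟨ Φ α s , Φ α s ⟩} initial n r
        where
        initial : ∀ r → A M s 0 r ≈ paths 0 r s * ⟨ Φ α s , Φ α s ⟩
        initial r with r ℕ.≟ s
        ... | yes ≡.refl rewrite dec-true (r ℕ.≟ r) ≡.refl =
          trans {A M r 0 r} {⟨ Φ α r , Φ α r ⟩} {1ᶜ * ⟨ Φ α r , Φ α r ⟩} (A-zero M r r)
            (sym {1ᶜ * ⟨ Φ α r , Φ α r ⟩} {⟨ Φ α r , Φ α r ⟩} (*-identityˡ ⟨ Φ α r , Φ α r ⟩))
        ... | no r≢s rewrite dec-false (r ℕ.≟ s) r≢s = begin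
          A M s 0 r                     ≈⟨ A-zero M s r ⟩
          ⟨ Φ α s , Φ α r ⟩             ≈⟨ orthogonal′ s r (r≢s ∘ ≡.sym) ⟩
          0ᶜ                            ≈⟨ zeroˡ ⟨ Φ α s , Φ α s ⟩ ⟨
          0ᶜ * ⟨ Φ α s , Φ α s ⟩        ∎

      form : Laurent → Laurent → ℂ
      form f g = ⟨ f , g ⟩[ 𝓛 ]

      form≈ : ∀ f g → form f g ≈ ⟨ f , g ⟩
      form≈ f g = 𝓛≈ev (f *ᴸ g ~)

      form-Φ-Φ≉0 : (∀ n → ∣ α n ∣< 1ᴿ) → ∀ n → form (Φ α n) (Φ α n) ≉0
      form-Φ-Φ≉0 α<1 n = ≈ofReal⇒≉0 {form (Φ α n) (Φ α n)} {norm n}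
        (trans {form (Φ α n) (Φ α n)} {⟨ Φ α n , Φ α n ⟩} {ofReal (norm n)}
          (form≈ (Φ α n) (Φ α n)) (⟨Φ,Φ⟩≈norm n))
        (norm-positive α<1 n)

      form-expansion : ∀ n r s → form (Φ α s) (z^ (+ n) *ᴸ Φ α r)
                               ≈ ∑[ 𝔏-enumeration n r s ] (wt α) * form (Φ α s) (Φ α s)
      form-expansion n r s = begin
        form (Φ α s) (z^ (+ n) *ᴸ Φ α r)       ≈⟨ form≈ (Φ α s) (z^ (+ n) *ᴸ Φ α r) ⟩
        ⟨ Φ α s , z^ (+ n) *ᴸ Φ α r ⟩          ≈⟨ expand n r s ⟩
        paths n r s * ⟨ Φ α s , Φ α s ⟩
          ≈⟨ *-cong {∑[ 𝔏-enumeration n r s ] (wt α)} {paths n r s}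
               {form (Φ α s) (Φ α s)} {⟨ Φ α s , Φ α s ⟩}
               (∑-wt≈paths 0 n r s) (form≈ (Φ α s) (Φ α s)) ⟨
        ∑[ 𝔏-enumeration n r s ] (wt α) * form (Φ α s) (Φ α s) ∎

open Defs using (_≈_)

theorem3p4 : (α : ℕ → ℂ) → (∀ n → ∣ α n ∣< 1ᴿ) →
    (𝓛 : Laurent → ℂ) → IsMomentFunctional α 𝓛 →
    (n r s : ℕ) →
    Σ (⟨ Φ α s , Φ α s ⟩[ 𝓛 ] ≉0) λ nonzero →
    μ α 𝓛 n r s nonzero ≈ ∑[ 𝔏-enumeration n r s ] (wt α)
theorem3p4 α α<1 𝓛 isMoment n r s = form-Φ-Φ≉0 α 𝓛 isMoment α<1 s ,
  -- After multiplication by the norm of Φₛ, the claim is `form-expansion`.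
  /-unique ⟨ Φ α s , z^ (+ n) *ᴸ Φ α r ⟩[ 𝓛 ] ⟨ Φ α s , Φ α s ⟩[ 𝓛 ] (∑[ 𝔏-enumeration n r s ] (wt α))
    {form-Φ-Φ≉0 α 𝓛 isMoment α<1 s} (form-expansion α 𝓛 isMoment n r s)
  where
  open ComplexNumbers using (/-unique)
  open OrthogonalPolynomials using (form-Φ-Φ≉0; form-expansion)
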